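{- Every pairwise linked lobster is graceful.
   Context: A graph $G=(V,E)$ with $m$ edges is graceful if there is an injective $f:V\to\{0,\ldots,m\}$ (a graceful labeling) with the edge labels $|f(u)-f(v)|$, $uv\in E$, pairwise distinct. A lobster is a tree whose base (the tree obtained by deleting all degree-one vertices) is a caterpillar, a caterpillar being a tree whose base is a path. A lobster $L$ is described by a spine, a path $(v_1,\ldots,v_r)$, together with, for each $i$, a tree $F_i$ (the lobe at $v_i$), the lobes pairwise vertex-disjoint and each meeting the spine only in $v_i$, with $L$ the union of the spine and the lobes; each lobe $F_i$ consists of $v_i$, vertices $u_{i1},\ldots,u_{is_i}$ ($s_i\ge 0$) adjacent to $v_i$, and for each $j$ some $k_{ij}\ge0$ further vertices adjacent only to $u_{ij}$. If $k_{ij}=0$, $u_{ij}$ is a pendant vertex at $v_i$; the reduced lobe $F'_i$ is $F_i$ with all pendant vertices at $v_i$ deleted. For two vertex-disjoint graceful graphs $G_1,G_2$ with given graceful labelings, $G_1\circ G_2$ denotes the graph obtained by identifying the maximum-labeled vertex of $G_1$ with the maximum-labeled vertex of $G_2$. $L$ is pairwise linked if there are trees $G_1,\ldots,G_r$ of diameter $4$, each with a graceful labeling in which its central vertex has the maximum label, such that $F'_i\cong G_i\circ G_{i+1}$ for each $i=1,\ldots,r-1$ and $F'_r\cong G_r$. -}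

module Defs where

open import Data.Fin using (Fin; zero; suc; toℕ; fromℕ; inject₁; _<?_)
open import Data.List using (List; length; filter; allFin; cartesianProduct)
open import Data.Nat using (ℕ; zero; suc; _≤_; _+_; ∣_-_∣)
open import Data.Nat.Properties using (1+n≢n)
open import Data.Product using (Σ; ∃-syntax; ∃!; _×_; _,_; proj₁; proj₂)
open import Data.Refinement using (Refinement; Refinement-syntax; value)
open import Data.Sum using (_⊎_; inj₁; inj₂)
open import Function.Bundles using (_↔_; _⇔_; Inverse)
open import Function.Definitions using (Injective)
open import Level using (0ℓ)
open import Relation.Binary.Core using (Rel)
open import Relation.Binary.Definitions using (Symmetric; Irreflexive; Decidable)
open import Relation.Binary.Construct.Closure.Symmetric
  using (SymClosure; fwd; bwd; symmetric)
open import Relation.Binary.PropositionalEquality using (_≡_; _≢_; refl; sym)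
open import Relation.Nullary using (¬_)
open import Relation.Nullary.Decidable using (_×-dec_)

------------------------------------------------------------------------
-- Simple graphs

record Graph : Set₁ where
  field
    V       : Set
    Adj     : Rel V 0ℓ
    adj-sym : Symmetric Adj
    adj-irr : Irreflexive _≡_ Adj

open Graph public

record _≅_ (G H : Graph) : Set where
  field
    bij      : V G ↔ V H
    adj⇔adj : ∀ u v → Adj G u v ⇔ Adj H (Inverse.to bij u) (Inverse.to bij v)

induced : (G : Graph) → (V G → Set) → Graph
induced G P = record
  { V       = [ v ∈ V G ∣ P v ]
  ; Adj     = λ u v → Adj G (value u) (value v)
  ; adj-sym = adj-sym G
  ; adj-irr = λ { refl → adj-irr G refl }
  }

record FiniteGraph : Set₁ where
  field
    graph : Graph
    order : ℕ
    enum  : V graph ↔ Fin order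
    adj?  : Decidable (Adj graph)

open FiniteGraph public

-- Each edge is listed once, as a pair that is increasing in the enumeration
-- of the vertices; `size G` does not depend on that enumeration.
edges : (G : FiniteGraph) → List (Fin (order G) × Fin (order G))
edges G = filter
  (λ e → (proj₁ e <? proj₂ e) ×-dec adj? G (from (proj₁ e)) (from (proj₂ e)))
  (cartesianProduct (allFin (order G)) (allFin (order G)))
  where open Inverse (enum G) using (from)

size : FiniteGraph → ℕ
size G = length (edges G)

------------------------------------------------------------------------
-- Distances

data Walk (G : Graph) : V G → V G → ℕ → Set where
  []  : ∀ {v} → Walk G v v 0
  _∷_ : ∀ {u v w n} → Adj G u v → Walk G v w n → Walk G u w (suc n)

Distance : (G : Graph) → V G → V G → ℕ → Set
Distance G u v d = Walk G u v d × (∀ {n} → Walk G u v n → d ≤ n)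

Eccentricity : (G : Graph) → V G → ℕ → Set
Eccentricity G v e =
  (∃[ u ] Distance G v u e) × (∀ {u d} → Distance G v u d → d ≤ e)

Diameter : Graph → ℕ → Set
Diameter G d =
  (∃[ u ] ∃[ v ] Distance G u v d) × (∀ {u v e} → Distance G u v e → e ≤ d)

IsCentral : (G : Graph) → V G → Set
IsCentral G c =
  ∃[ e ] Eccentricity G c e × (∀ {v e′} → Eccentricity G v e′ → e ≤ e′)

------------------------------------------------------------------------
-- Trees, caterpillars, lobsters

Connected : Graph → Set
Connected G = ∀ u v → ∃[ n ] Walk G u v n

record Cycle (G : Graph) : Set where
  field
    {len-3}  : ℕ
    vertex   : Fin (3 + len-3) → V G
    distinct : Injective _≡_ _≡_ vertex
    step     : ∀ i → Adj G (vertex (inject₁ i)) (vertex (suc i))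
    close    : Adj G (vertex (fromℕ (2 + len-3))) (vertex zero)

record IsTree (G : Graph) : Set where
  field
    nonempty  : V G
    connected : Connected G
    acyclic   : ¬ Cycle G

Consecutive : ∀ {n} → Rel (Fin n) 0ℓ
Consecutive i j = toℕ j ≡ suc (toℕ i)

pathGraph : ℕ → Graph
pathGraph n = record
  { V       = Fin n
  ; Adj     = SymClosure Consecutive
  ; adj-sym = symmetric Consecutive
  ; adj-irr = λ { refl (fwd e) → 1+n≢n (sym e) ; refl (bwd e) → 1+n≢n (sym e) }
  }

-- The graph with no vertices is not counted as a path.
IsPath : Graph → Set
IsPath G = ∃[ n ] (G ≅ pathGraph (suc n))

DegreeOne : (G : Graph) → V G → Set
DegreeOne G v = ∃! _≡_ (Adj G v)

base : Graph → Graph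
base G = induced G (λ v → ¬ DegreeOne G v)

IsCaterpillar : Graph → Set
IsCaterpillar G = IsTree G × IsPath (base G)

IsLobster : Graph → Set
IsLobster G = IsTree G × IsCaterpillar (base G)

------------------------------------------------------------------------
-- Graceful labelings

record GracefulLabeling (G : FiniteGraph) : Set where
  field
    label     : V (graph G) → Fin (suc (size G))
    injective : Injective _≡_ _≡_ label

  edgeLabel : V (graph G) → V (graph G) → ℕ
  edgeLabel u v = ∣ toℕ (label u) - toℕ (label v) ∣

  field
    edges-distinct : ∀ {u v x y} → Adj (graph G) u v → Adj (graph G) x y →
      edgeLabel u v ≡ edgeLabel x y → (u ≡ x × v ≡ y) ⊎ (u ≡ y × v ≡ x)

Graceful : FiniteGraph → Set
Graceful G = GracefulLabeling G

record GracefullyLabeled : Set₁ where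
  field
    finiteGraph : FiniteGraph
    labeling    : GracefulLabeling finiteGraph
  open GracefulLabeling labeling public
  field
    top         : V (graph finiteGraph)
    top-maximum : ∀ v → toℕ (label v) ≤ toℕ (label top)

  underlying : Graph
  underlying = graph finiteGraph

open GracefullyLabeled public using (underlying; top)

-- The disjoint union of G and H with `top H` removed; `top G` takes over the
-- role of `top H`, acquiring its neighbours.
_∘_ : GracefullyLabeled → GracefullyLabeled → Graph
G ∘ H = record
  { V       = V₁ ⊎ V₂
  ; Adj     = _~_
  ; adj-sym = λ {a} {b} → ~-sym a b
  ; adj-irr = λ { {a} refl → ~-irr a }
  }
  where
  V₁ V₂ : Set
  V₁ = V (underlying G)
  V₂ = [ v ∈ V (underlying H) ∣ v ≢ top H ]

  _~_ : Rel (V₁ ⊎ V₂) 0ℓ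
  inj₁ u ~ inj₁ v = Adj (underlying G) u v
  inj₁ u ~ inj₂ v = u ≡ top G × Adj (underlying H) (top H) (value v)
  inj₂ u ~ inj₁ v = v ≡ top G × Adj (underlying H) (value u) (top H)
  inj₂ u ~ inj₂ v = Adj (underlying H) (value u) (value v)

  ~-sym : ∀ a b → a ~ b → b ~ a
  ~-sym (inj₁ u) (inj₁ v) e       = adj-sym (underlying G) e
  ~-sym (inj₁ u) (inj₂ v) (p , e) = p , adj-sym (underlying H) e
  ~-sym (inj₂ u) (inj₁ v) (p , e) = p , adj-sym (underlying H) e
  ~-sym (inj₂ u) (inj₂ v) e       = adj-sym (underlying H) e

  ~-irr : ∀ a → ¬ (a ~ a)
  ~-irr (inj₁ u) = adj-irr (underlying G) refl
  ~-irr (inj₂ u) = adj-irr (underlying H) refl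

------------------------------------------------------------------------
-- Lobes and the spine

-- The root v has neighbours u_j (j < arms), and u_j has leaves j further
-- neighbours.
record Lobe : Set where
  field
    arms   : ℕ
    leaves : Fin arms → ℕ

open Lobe public

data LobeVertex (F : Lobe) : Set where
  root : LobeVertex F
  arm  : Fin (arms F) → LobeVertex F
  leaf : (j : Fin (arms F)) → Fin (leaves F j) → LobeVertex F

data LobeEdge (F : Lobe) : Rel (LobeVertex F) 0ℓ where
  root-arm : ∀ j → LobeEdge F root (arm j)
  arm-leaf : ∀ j l → LobeEdge F (arm j) (leaf j l)

lobeGraph : Lobe → Graph
lobeGraph F = record
  { V       = LobeVertex F
  ; Adj     = SymClosure (LobeEdge F)
  ; adj-sym = symmetric (LobeEdge F)
  ; adj-irr = λ { refl (fwd ()) ; refl (bwd ()) }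
  }

data Pendant (F : Lobe) : LobeVertex F → Set where
  pendant : ∀ {j} → leaves F j ≡ 0 → Pendant F (arm j)

reducedLobe : Lobe → Graph
reducedLobe F = induced (lobeGraph F) (λ v → ¬ Pendant F v)

data SpineLobeAdj {r} (F : Fin r → Lobe) : Rel (Σ (Fin r) λ i → LobeVertex (F i)) 0ℓ where
  in-lobe  : ∀ {i x y} → Adj (lobeGraph (F i)) x y → SpineLobeAdj F (i , x) (i , y)
  on-spine : ∀ {i j} → Adj (pathGraph r) i j → SpineLobeAdj F (i , root) (j , root)

-- The union of the spine, on the roots of the lobes, and the disjoint lobes.
spineLobeGraph : ∀ {r} → (Fin r → Lobe) → Graph
spineLobeGraph {r} F = record
  { V       = Σ (Fin r) λ i → LobeVertex (F i)
  ; Adj     = SpineLobeAdj F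
  ; adj-sym = λ { (in-lobe {i} e) → in-lobe (adj-sym (lobeGraph (F i)) e)
                ; (on-spine e)    → on-spine (adj-sym (pathGraph r) e) }
  ; adj-irr = λ { refl (in-lobe {i} e) → adj-irr (lobeGraph (F i)) refl e
                ; refl (on-spine e)    → adj-irr (pathGraph r) refl e }
  }

------------------------------------------------------------------------
-- Pairwise linked lobsters

record LinkTree : Set₁ where
  field
    labeled     : GracefullyLabeled
    isTree      : IsTree (underlying labeled)
    diameter-4  : Diameter (underlying labeled) 4
    top-central : IsCentral (underlying labeled) (top labeled)

open LinkTree public using (labeled)

-- The spine has r = suc p vertices.
record PairwiseLinked (L : Graph) : Set₁ where
  field
    {p}  : ℕ
    lobe : Fin (suc p) → Lobe
    desc : L ≅ spineLobeGraph lobe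
    link : Fin (suc p) → LinkTree
    linked : ∀ (i : Fin p) →
      reducedLobe (lobe (inject₁ i)) ≅ (labeled (link (inject₁ i)) ∘ labeled (link (suc i)))
    linked-last :
      reducedLobe (lobe (fromℕ p)) ≅ underlying (labeled (link (fromℕ p)))

{-# OPTIONS --safe #-}
module Submission where

-- Let F′ᵢ ≅ Gᵢ ∘ Gᵢ₊₁.  The centre of Gᵢ corresponds to the spine vertex vᵢ, so for i ≥ 2
-- the lobster contains two copies of Gᵢ, one at vᵢ₋₁ and one at vᵢ, whose centres are joined
-- by a spine edge.  Let f be the labeling of Gᵢ, with m edges, and shift f by a constant c on
-- the odd vertices of the first copy and on the even vertices of the second: the edge labels
-- become c ± d for 1 ≤ d ≤ m, and c on the spine edge.  With c = m + K + 1 this leaves room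
-- for the part already labeled, which has K edges and label 0 at vᵢ₋₁: it is shifted by m,
-- the label of the centre of the first copy.  The centre of the second copy has the largest
-- label; complementing makes it 0, pendant vertices at vᵢ then take the next labels
-- upwards, and the step repeats at vᵢ₊₁.  The start is G₁ with its labels complemented.

open import Defs

open import Data.Bool using (Bool; true; false; not)
open import Data.Empty using (⊥; ⊥-elim; ⊥-elim-irr)
open import Data.Fin using (Fin; zero; suc; toℕ; fromℕ; fromℕ<; inject₁)
import Data.Fin as Fin
open import Data.Fin.Properties
  using (toℕ<n; toℕ-injective; toℕ-fromℕ<; fromℕ<-injective; any?; injective⇒≤;
         punchOut-injective)
import Data.Fin.Properties as Fin
open import Data.List using (List; _∷_; lookup; filter; length; allFin; cartesianProduct)
open import Data.List.Membership.Propositional using (_∈_)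
open import Data.List.Membership.Propositional.Properties
  using (∈-lookup; ∈-filter⁺; ∈-filter⁻; ∈-allFin; ∈-cartesianProduct⁺)
import Data.List.Relation.Unary.All as All
open import Data.List.Relation.Unary.AllPairs using (_∷_)
open import Data.List.Relation.Unary.Any using (index)
open import Data.List.Relation.Unary.Any.Properties using (lookup-index)
open import Data.List.Relation.Unary.Unique.Propositional using (Unique)
open import Data.List.Relation.Unary.Unique.Propositional.Properties
  using (filter⁺; allFin⁺; cartesianProduct⁺)
open import Data.Maybe using (Maybe; just; nothing)
import Data.Maybe as Maybe
open import Data.Nat
open import Data.Nat.Properties
open import Data.Nat.Tactic.RingSolver using (solve-∀)
open import Data.Product using (Σ; ∃-syntax; ∃₂; _×_; _,_; proj₁; proj₂; swap)
import Data.Product as Product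
open import Data.Product.Properties using (,-injective)
open import Data.Refinement using (Refinement; value; value-injective) renaming (_,_ to _∣_)
open import Data.Irrelevant using ([_])
open import Data.Sum using (_⊎_; inj₁; inj₂)
import Data.Sum as Sum
open import Data.Sum.Properties using (inj₁-injective)
open import Function using (id; case_of_) renaming (_∘_ to _∘′_)
open import Function.Bundles using (Inverse; Equivalence)
open import Function.Definitions using (Injective)
open import Level using (0ℓ)
open import Relation.Binary.Core using (Rel)
open import Relation.Binary.Construct.Closure.Symmetric using (fwd; bwd)
open import Relation.Binary.Definitions using (Tri; tri<; tri≈; tri>)
open import Relation.Binary.PropositionalEquality
open import Relation.Nullary using (¬_; Dec; yes; no; contradiction)

-- Finite enumerations

-- Pigeonhole: a missed value `j` could be punched out of the range, leaving an injection of
-- `Fin (suc n)` into `Fin n`.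
injective⇒surjective : ∀ {n} {f : Fin n → Fin n} → Injective _≡_ _≡_ f → ∀ j → ∃[ i ] f i ≡ j
injective⇒surjective {suc n} {f} inj j with any? (λ i → f i Fin.≟ j)
... | yes hit = hit
... | no miss =
  contradiction (injective⇒≤ (λ eq → inj (punchOut-injective (≢f _) (≢f _) eq))) 1+n≰n
  where
  ≢f : ∀ i → j ≢ f i
  ≢f i eq = miss (i , sym eq)

-- Lowering the values by one turns `g` into an injective self-map of `Fin m`. In use, `g` lists the
-- edge labels of a graceful labeling.
positive-injective⇒surjective : ∀ {m} (g : Fin m → ℕ) → Injective _≡_ _≡_ g →
  (∀ i → 1 ≤ g i) → (∀ i → g i ≤ m) → ∀ {n} → 1 ≤ n → n ≤ m → ∃[ i ] g i ≡ n
positive-injective⇒surjective {m} g g-inj g≥1 g≤m {suc n} _ n<m =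
  let (i , eq) = injective⇒surjective h-injective (fromℕ< n<m)
  in i , pred-injective ⦃ >-nonZero (g≥1 i) ⦄ (fromℕ<-injective _ _ (pred-g<m i) n<m eq)
  where
  pred-g<m : ∀ i → pred (g i) < m
  pred-g<m i with g i | g≥1 i | g≤m i
  ... | suc _ | _ | g≤ = g≤

  h : Fin m → Fin m
  h i = fromℕ< (pred-g<m i)

  h-injective : Injective _≡_ _≡_ h
  h-injective {i} {j} eq = g-inj (pred-injective ⦃ >-nonZero (g≥1 i) ⦄ ⦃ >-nonZero (g≥1 j) ⦄
    (fromℕ<-injective _ _ (pred-g<m i) (pred-g<m j) eq))

lookup-injective : ∀ {A : Set} {xs : List A} → Unique xs → Injective _≡_ _≡_ (lookup xs)
lookup-injective (_ ∷ _)   {zero}  {zero}  _  = refl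
lookup-injective (x∉ ∷ _)  {zero}  {suc j} eq = contradiction eq (All.lookup x∉ (∈-lookup j))
lookup-injective (x∉ ∷ _)  {suc i} {zero}  eq = contradiction (sym eq) (All.lookup x∉ (∈-lookup i))
lookup-injective (_ ∷ xs!) {suc i} {suc j} eq = cong suc (lookup-injective xs! eq)

module _ (G : FiniteGraph) where

  open Inverse (enum G) using (to; from; inverseˡ; inverseʳ)

  from-injective : Injective _≡_ _≡_ from
  from-injective eq = trans (sym (inverseˡ refl)) (trans (cong to eq) (inverseˡ refl))

  endpoints : Fin (size G) → V (graph G) × V (graph G)
  endpoints i = Product.map from from (lookup (edges G) i)

  private
    lookup-edge : ∀ i → let e = lookup (edges G) i in
      proj₁ e Fin.< proj₂ e × Adj (graph G) (from (proj₁ e)) (from (proj₂ e))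
    lookup-edge i = proj₂ (∈-filter⁻ _ {xs = cartesianProduct (allFin (order G)) _} (∈-lookup i))

    edges-unique : Unique (edges G)
    edges-unique = filter⁺ _ (cartesianProduct⁺ (allFin⁺ _) (allFin⁺ _))

  endpoints-adjacent : ∀ i → Adj (graph G) (proj₁ (endpoints i)) (proj₂ (endpoints i))
  endpoints-adjacent i = proj₂ (lookup-edge i)

  endpoints-injective : Injective _≡_ _≡_ endpoints
  endpoints-injective eq with ,-injective eq
  ... | p , q = lookup-injective edges-unique (cong₂ _,_ (from-injective p) (from-injective q))

  -- `edges` holds increasing pairs only, so no edge is listed in both directions.
  endpoints≢swap : ∀ i j → endpoints i ≢ swap (endpoints j)
  endpoints≢swap i j eq with ,-injective eq
  ... | p , q = <-asym (proj₁ (lookup-edge i))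
    (subst₂ Fin._<_ (sym (from-injective q)) (sym (from-injective p)) (proj₁ (lookup-edge j)))

  endpoints-surjective : ∀ {u v} → Adj (graph G) u v →
    ∃[ i ] (endpoints i ≡ (u , v) ⊎ endpoints i ≡ (v , u))
  endpoints-surjective {u} {v} a with Fin.<-cmp (to u) (to v)
  ... | tri< u<v _ _ = index mem , inj₁ (trans (cong (Product.map from from) (sym (lookup-index mem)))
                         (cong₂ _,_ (inverseʳ refl) (inverseʳ refl)))
    where
    mem : (to u , to v) ∈ edges G
    mem = ∈-filter⁺ _ (∈-cartesianProduct⁺ (∈-allFin _) (∈-allFin _))
      (u<v , subst₂ (Adj (graph G)) (sym (inverseʳ refl)) (sym (inverseʳ refl)) a)
  ... | tri≈ _ eq _ =
    contradiction a (adj-irr (graph G) (trans (sym (inverseʳ refl)) (trans (cong from eq) (inverseʳ refl))))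
  ... | tri> _ _ v<u = index mem , inj₂ (trans (cong (Product.map from from) (sym (lookup-index mem)))
                         (cong₂ _,_ (inverseʳ refl) (inverseʳ refl)))
    where
    mem : (to v , to u) ∈ edges G
    mem = ∈-filter⁺ _ (∈-cartesianProduct⁺ (∈-allFin _) (∈-allFin _))
      (v<u , subst₂ (Adj (graph G)) (sym (inverseʳ refl)) (sym (inverseʳ refl)) (adj-sym (graph G) a))

-- Graceful labelings of relations

-- By gap-injective an edge is related in one direction only, and gap-surjective makes
-- bound the number of edges without counting them.
record GracefulOn {A : Set} (E : Rel A 0ℓ) : Set where
  field
    bound           : ℕ
    label           : A → ℕ
    label≤bound     : ∀ a → label a ≤ bound
    label-injective : Injective _≡_ _≡_ label

  gap : A → A → ℕ
  gap a b = ∣ label a - label b ∣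

  field
    gap-injective  : ∀ {a b c d} → E a b → E c d → gap a b ≡ gap c d → a ≡ c × b ≡ d
    gap-surjective : ∀ {n} → 1 ≤ n → n ≤ bound → ∃₂ λ a b → E a b × gap a b ≡ n

  gap≤bound : ∀ a b → gap a b ≤ bound
  gap≤bound a b =
    ≤-trans (∣m-n∣≤m⊔n (label a) (label b)) (⊔-lub (label≤bound a) (label≤bound b))

open GracefulOn

transport : ∀ {A B : Set} {E : Rel A 0ℓ} {F : Rel B 0ℓ} (g : B → A) → Injective _≡_ _≡_ g →
  (∀ {x y} → F x y → E (g x) (g y)) →
  (∀ {a b} → E a b → ∃₂ λ x y → F x y × g x ≡ a × g y ≡ b) →
  GracefulOn E → GracefulOn F
transport g g-inj hom lift γ = record
  { bound           = bound γ
  ; label           = λ x → label γ (g x)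
  ; label≤bound     = λ x → label≤bound γ (g x)
  ; label-injective = λ eq → g-inj (label-injective γ eq)
  ; gap-injective   = λ e f eq → Product.map g-inj g-inj (gap-injective γ (hom e) (hom f) eq)
  ; gap-surjective  = λ l h → case gap-surjective γ l h of λ where
      (a , b , e , eq) → case lift e of λ where
        (x , y , f , refl , refl) → x , y , f , eq
  }

-- Adding `a + b` to both sides clears the truncated subtractions.
∣m∸a-m∸b∣≡∣a-b∣ : ∀ {m a b} → a ≤ m → b ≤ m → ∣ (m ∸ a) - (m ∸ b) ∣ ≡ ∣ a - b ∣
∣m∸a-m∸b∣≡∣a-b∣ {m} {a} {b} a≤m b≤m = begin
  ∣ (m ∸ a) - (m ∸ b) ∣                      ≡⟨ ∣m+n-m+o∣≡∣n-o∣ (a + b) (m ∸ a) (m ∸ b) ⟨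
  ∣ a + b + (m ∸ a) - (a + b + (m ∸ b)) ∣    ≡⟨ cong₂ ∣_-_∣ eq₁ eq₂ ⟩
  ∣ m + b - (m + a) ∣                        ≡⟨ ∣m+n-m+o∣≡∣n-o∣ m b a ⟩
  ∣ b - a ∣                                  ≡⟨ ∣-∣-comm b a ⟩
  ∣ a - b ∣                                  ∎
  where
  open ≡-Reasoning
  eq₁ : a + b + (m ∸ a) ≡ m + b
  eq₁ = trans (cong (_+ (m ∸ a)) (+-comm a b)) (trans (+-assoc b a _)
    (trans (cong (b +_) (m+[n∸m]≡n a≤m)) (+-comm b m)))
  eq₂ : a + b + (m ∸ b) ≡ m + a
  eq₂ = trans (+-assoc a b _) (trans (cong (a +_) (m+[n∸m]≡n b≤m)) (+-comm a m))

-- Reflecting the labels preserves all gaps and exchanges label `bound` with label 0, so a vertex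
-- with the largest label can serve as the next root.
complement : ∀ {A : Set} {E : Rel A 0ℓ} → GracefulOn E → GracefulOn E
complement γ = record
  { bound           = bound γ
  ; label           = λ a → bound γ ∸ label γ a
  ; label≤bound     = λ a → m∸n≤m (bound γ) (label γ a)
  ; label-injective = λ {a} {b} eq →
      label-injective γ (∸-cancelˡ-≡ (label≤bound γ a) (label≤bound γ b) eq)
  ; gap-injective   = λ e f eq →
      gap-injective γ e f (trans (sym (same _ _)) (trans eq (same _ _)))
  ; gap-surjective  = λ l h → case gap-surjective γ l h of λ where
      (a , b , e , eq) → a , b , e , trans (same a b) eq
  }
  where
  same : ∀ a b → ∣ (bound γ ∸ label γ a) - (bound γ ∸ label γ b) ∣ ≡ gap γ a b
  same a b = ∣m∸a-m∸b∣≡∣a-b∣ (label≤bound γ a) (label≤bound γ b)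

-- Each value from 1 to `bound` is the gap of some edge of `L`, and different gaps need different
-- edges. Hence `bound γ` is at most `size L`, and the labels fit the range that `Graceful`
-- prescribes.
gracefulOn⇒graceful : ∀ {A : Set} {E : Rel A 0ℓ} (L : FiniteGraph) (g : V (graph L) → A) →
  Injective _≡_ _≡_ g →
  (∀ {u v} → Adj (graph L) u v → E (g u) (g v) ⊎ E (g v) (g u)) →
  (∀ {a b} → E a b → ∃₂ λ u v → Adj (graph L) u v × g u ≡ a × g v ≡ b) →
  GracefulOn E → Graceful L
gracefulOn⇒graceful {E = E} L g g-inj hom lift γ = record
  { label          = ℓ
  ; injective      = λ {u} {v} eq → g-inj (label-injective γ
      (trans (sym (toℕ-ℓ u)) (trans (cong toℕ eq) (toℕ-ℓ v))))
  ; edges-distinct = λ {u} {v} {x} {y} a b eq → distinct (hom a) (hom b)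
      (trans (cong₂ ∣_-_∣ (sym (toℕ-ℓ u)) (sym (toℕ-ℓ v)))
        (trans eq (cong₂ ∣_-_∣ (toℕ-ℓ x) (toℕ-ℓ y))))
  }
  where
  ends : ∀ (d : Fin (bound γ)) → ∃₂ λ u v → Adj (graph L) u v × gap γ (g u) (g v) ≡ suc (toℕ d)
  ends d with gap-surjective γ (s≤s z≤n) (toℕ<n d)
  ... | a , b , e , eq with lift e
  ... | u , v , adj , refl , refl = u , v , adj , eq

  edgeIndex : Fin (bound γ) → Fin (size L)
  edgeIndex d = let (_ , _ , adj , _) = ends d in proj₁ (endpoints-surjective L adj)

  pairGap : V (graph L) × V (graph L) → ℕ
  pairGap (u , v) = gap γ (g u) (g v)

  pairGap-edgeIndex : ∀ d → pairGap (endpoints L (edgeIndex d)) ≡ suc (toℕ d)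
  pairGap-edgeIndex d with ends d
  ... | u , v , adj , eq with endpoints-surjective L adj
  ... | i , inj₁ p = trans (cong pairGap p) eq
  ... | i , inj₂ p = trans (cong pairGap p) (trans (∣-∣-comm (label γ (g v)) _) eq)

  bound≤size : bound γ ≤ size L
  bound≤size = injective⇒≤ {f = edgeIndex} λ {d} {d′} eq → toℕ-injective (suc-injective
    (trans (sym (pairGap-edgeIndex d)) (trans (cong (pairGap ∘′ endpoints L) eq) (pairGap-edgeIndex d′))))

  ℓ<1+size : ∀ u → label γ (g u) < suc (size L)
  ℓ<1+size u = s≤s (≤-trans (label≤bound γ (g u)) bound≤size)

  ℓ : V (graph L) → Fin (suc (size L))
  ℓ u = fromℕ< (ℓ<1+size u)

  toℕ-ℓ : ∀ u → toℕ (ℓ u) ≡ label γ (g u)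
  toℕ-ℓ u = toℕ-fromℕ< (ℓ<1+size u)

  distinct : ∀ {u v x y} → E (g u) (g v) ⊎ E (g v) (g u) → E (g x) (g y) ⊎ E (g y) (g x) →
    gap γ (g u) (g v) ≡ gap γ (g x) (g y) → (u ≡ x × v ≡ y) ⊎ (u ≡ y × v ≡ x)
  distinct (inj₁ e) (inj₁ f) eq = inj₁ (Product.map g-inj g-inj (gap-injective γ e f eq))
  distinct {x = x} (inj₁ e) (inj₂ f) eq = inj₂ (Product.map g-inj g-inj
    (gap-injective γ e f (trans eq (∣-∣-comm (label γ (g x)) _))))
  distinct {u} (inj₂ e) (inj₁ f) eq = inj₂ (swap (Product.map g-inj g-inj
    (gap-injective γ e f (trans (∣-∣-comm _ (label γ (g u))) eq))))
  distinct {u} {x = x} (inj₂ e) (inj₂ f) eq = inj₁ (swap (Product.map g-inj g-inj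
    (gap-injective γ e f (trans (∣-∣-comm _ (label γ (g u))) (trans eq (∣-∣-comm (label γ (g x)) _))))))

-- Edge labels and the largest vertex label of a graceful labeling

module _ (G : GracefullyLabeled) where

  open GracefullyLabeled G using (finiteGraph; labeling; top-maximum)
  open GracefulLabeling labeling renaming (label to ℓ)

  height : V (underlying G) → ℕ
  height v = toℕ (ℓ v)

  height-injective : Injective _≡_ _≡_ height
  height-injective eq = injective (toℕ-injective eq)

  height≤size : ∀ v → height v ≤ size finiteGraph
  height≤size v = s≤s⁻¹ (toℕ<n (ℓ v))

  -- The `size` many edge labels are distinct, positive because adjacent vertices have different
  -- labels, and at most `size`; so they exhaust the range.
  edgeLabel-surjective : ∀ {n} → 1 ≤ n → n ≤ size finiteGraph →
    ∃₂ λ u v → Adj (underlying G) u v × edgeLabel u v ≡ n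
  edgeLabel-surjective l h =
    let (i , eq) = positive-injective⇒surjective endGap endGap-injective
                     (λ j → edgeLabel≥1 (endpoints-adjacent finiteGraph j)) (λ j → edgeLabel≤size _ _) l h
    in _ , _ , endpoints-adjacent finiteGraph i , eq
    where
    endGap : Fin (size finiteGraph) → ℕ
    endGap i = let (u , v) = endpoints finiteGraph i in edgeLabel u v

    edgeLabel≥1 : ∀ {u v} → Adj (underlying G) u v → 1 ≤ edgeLabel u v
    edgeLabel≥1 a = n≢0⇒n>0 λ eq → adj-irr (underlying G) (height-injective (∣m-n∣≡0⇒m≡n eq)) a

    edgeLabel≤size : ∀ u v → edgeLabel u v ≤ size finiteGraph
    edgeLabel≤size u v = ≤-trans (∣m-n∣≤m⊔n (height u) (height v)) (⊔-lub (height≤size u) (height≤size v))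

    endGap-injective : Injective _≡_ _≡_ endGap
    endGap-injective {i} {j} eq =
      Sum.[ (λ (p , q) → endpoints-injective finiteGraph (cong₂ _,_ p q))
          , (λ (p , q) → contradiction (cong₂ _,_ p q) (endpoints≢swap finiteGraph i j))
          ]′ (edges-distinct (endpoints-adjacent finiteGraph i) (endpoints-adjacent finiteGraph j) eq)

  -- Some edge has label size, hence one of its ends has vertex label size.
  height-top : height (top G) ≡ size finiteGraph
  height-top = ≤-antisym (height≤size _) (lower (size finiteGraph) refl)
    where
    lower : ∀ m → m ≡ size finiteGraph → m ≤ height (top G)
    lower zero    _  = z≤n
    lower (suc m) eq =
      let (u , v , _ , gap≡) = edgeLabel-surjective (s≤s z≤n) (≤-reflexive eq)
      in ≤-trans (≤-reflexive (sym gap≡))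
           (≤-trans (∣m-n∣≤m⊔n (height u) (height v)) (⊔-lub (top-maximum u) (top-maximum v)))

-- Labeled trees with a bipartition

record Colouring (G : GracefullyLabeled) : Set where
  field
    even     : V (underlying G) → Bool
    even-top : even (top G) ≡ true
    even-adj : ∀ {u v} → Adj (underlying G) u v → even v ≡ not (even u)

record Piece : Set₁ where
  field
    tree      : GracefullyLabeled
    colouring : Colouring tree

  open Colouring colouring public

  Vertex : Set
  Vertex = V (underlying tree)

  -- Directing edges from the even to the odd class picks one direction for each edge, as
  -- `gap-injective` demands.
  record Edge (u v : Vertex) : Set where
    pattern; constructor mkEdge
    field
      adj       : Adj (underlying tree) u v
      even-tail : even u ≡ true
      odd-head  : even v ≡ false

  orient : ∀ {u v} → Adj (underlying tree) u v → Edge u v ⊎ Edge v u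
  orient {u} {v} a with even u in eu | even v in ev | even-adj a
  ... | true  | false | _ = inj₁ (mkEdge a eu ev)
  ... | false | true  | _ = inj₂ (mkEdge (adj-sym (underlying tree) a) ev eu)

  orient-top : ∀ {v} → Adj (underlying tree) (top tree) v → Edge (top tree) v
  orient-top a = mkEdge a even-top (trans (even-adj a) (cong not even-top))

  m : ℕ
  m = size (GracefullyLabeled.finiteGraph tree)

  f : Vertex → ℕ
  f = height tree

  edge-injective : ∀ {u v x y} → Edge u v → Edge x y → ∣ f u - f v ∣ ≡ ∣ f x - f y ∣ → u ≡ x × v ≡ y
  edge-injective (mkEdge a eu ev) (mkEdge b ex ey) eq = Sum.[ id ,
      -- The reversed match would make a vertex both even and odd.
      (λ { (refl , _) → contradiction (trans (sym eu) ey) λ () })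
    ]′ (GracefullyLabeled.edges-distinct tree a b eq)

  edge-surjective : ∀ {n} → 1 ≤ n → n ≤ m → ∃₂ λ u v → Edge u v × ∣ f u - f v ∣ ≡ n
  edge-surjective l h =
    let (u , v , a , eq) = edgeLabel-surjective tree l h
    in Sum.[ (λ e → u , v , e , eq)
           , (λ e → v , u , e , trans (∣-∣-comm (f v) (f u)) eq)
           ]′ (orient a)

  gracefulOn : GracefulOn Edge
  gracefulOn = record
    { bound           = m
    ; label           = f
    ; label≤bound     = height≤size tree
    ; label-injective = height-injective tree
    ; gap-injective   = edge-injective
    ; gap-surjective  = edge-surjective
    }

-- One-point unions

-- `Maybe R` is the vertex set of a graph about to be glued, with `nothing` as its glue point.
at : ∀ {A R : Set} → A → Maybe R → A ⊎ R
at a nothing  = inj₁ a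
at a (just r) = inj₂ r

-- The point nothing of F is identified with a.
data Join {A R : Set} (E : Rel A 0ℓ) (a : A) (F : Rel (Maybe R) 0ℓ) : Rel (A ⊎ R) 0ℓ where
  old : ∀ {x y} → E x y → Join E a F (inj₁ x) (inj₁ y)
  new : ∀ {x y} → F x y → Join E a F (at a x) (at a y)

data Star (s : ℕ) : Rel (Maybe (Fin s)) 0ℓ where
  ray : ∀ k → Star s nothing (just k)

Low : Piece → Set
Low P = Refinement (Piece.Vertex P) (λ v → v ≢ top (Piece.tree P))

-- Two copies of `P` with an edge between their tops. The low copy has its top at the glue point, so
-- its edges there get a constructor of their own; the top is even and occurs only as a tail.
data Double (P : Piece) : Rel (Maybe (Low P ⊎ Piece.Vertex P)) 0ℓ where
  low-top : ∀ {v} → Piece.Edge P (top (Piece.tree P)) (value v) → Double P nothing (just (inj₁ v))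
  low     : ∀ {u v} → Piece.Edge P (value u) (value v) → Double P (just (inj₁ u)) (just (inj₁ v))
  high    : ∀ {u v} → Piece.Edge P u v → Double P (just (inj₂ u)) (just (inj₂ v))
  tops    : Double P nothing (just (inj₂ (top (Piece.tree P))))

RootedGraceful : ∀ {A : Set} → Rel A 0ℓ → A → Set
RootedGraceful E r = Σ (GracefulOn E) λ γ → label γ r ≡ 0

-- The rays get the labels and, as the root has label 0, also the gaps `bound + 1` to `bound + s`,
-- all above the old ones.
addStar : ∀ {A : Set} {E : Rel A 0ℓ} {a} s → RootedGraceful E a →
  RootedGraceful (Join E a (Star s)) (inj₁ a)
addStar {A} {E} {a} s (γ , root0) = record
  { bound           = bound γ + s
  ; label           = ℓ
  ; label≤bound     = ℓ≤
  ; label-injective = ℓ-inj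
  ; gap-injective   = inj
  ; gap-surjective  = surj
  } , root0
  where
  ℓ : A ⊎ Fin s → ℕ
  ℓ (inj₁ x) = label γ x
  ℓ (inj₂ k) = suc (bound γ + toℕ k)

  ℓ≤ : ∀ x → ℓ x ≤ bound γ + s
  ℓ≤ (inj₁ x) = ≤-trans (label≤bound γ x) (m≤m+n _ s)
  ℓ≤ (inj₂ k) = ≤-trans (≤-reflexive (sym (+-suc (bound γ) (toℕ k)))) (+-monoʳ-≤ (bound γ) (toℕ<n k))

  too-big : ∀ {n} k → n ≤ bound γ → n ≢ suc (bound γ + toℕ k)
  too-big k n≤ refl = 1+n≰n (≤-trans (s≤s (m≤m+n _ _)) n≤)

  ℓ-inj : Injective _≡_ _≡_ ℓ
  ℓ-inj {inj₁ x} {inj₁ y} eq = cong inj₁ (label-injective γ eq)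
  ℓ-inj {inj₁ x} {inj₂ k} eq = contradiction eq (too-big k (label≤bound γ x))
  ℓ-inj {inj₂ k} {inj₁ x} eq = contradiction (sym eq) (too-big k (label≤bound γ x))
  ℓ-inj {inj₂ k} {inj₂ l} eq = cong inj₂ (toℕ-injective (+-cancelˡ-≡ (bound γ) _ _ (suc-injective eq)))

  ray-gap : ∀ (k : Fin s) → ∣ label γ a - suc (bound γ + toℕ k) ∣ ≡ suc (bound γ + toℕ k)
  ray-gap k = cong ∣_- suc (bound γ + toℕ k) ∣ root0

  inj : ∀ {x y z w} → Join E a (Star s) x y → Join E a (Star s) z w →
    ∣ ℓ x - ℓ y ∣ ≡ ∣ ℓ z - ℓ w ∣ → x ≡ z × y ≡ w
  inj (old e)       (old e′)      eq = Product.map (cong inj₁) (cong inj₁) (gap-injective γ e e′ eq)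
  inj (old e)       (new (ray k)) eq = contradiction (trans eq (ray-gap k)) (too-big k (gap≤bound γ _ _))
  inj (new (ray k)) (old e)       eq = contradiction (trans (sym eq) (ray-gap k)) (too-big k (gap≤bound γ _ _))
  inj (new (ray k)) (new (ray l)) eq =
    refl , ℓ-inj {inj₂ k} {inj₂ l} (trans (sym (ray-gap k)) (trans eq (ray-gap l)))

  surj : ∀ {n} → 1 ≤ n → n ≤ bound γ + s → ∃₂ λ x y → Join E a (Star s) x y × ∣ ℓ x - ℓ y ∣ ≡ n
  surj {n} l h with n ≤? bound γ
  ... | yes n≤ = let (x , y , e , eq) = gap-surjective γ l n≤ in _ , _ , old e , eq
  ... | no n≰ with d , refl ← m≤n⇒∃[o]m+o≡n (≰⇒> n≰) =
    _ , _ , new (ray (fromℕ< d<s)) ,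
      trans (ray-gap _) (cong (λ t → suc (bound γ + t)) (toℕ-fromℕ< d<s))
    where
    d<s : d < s
    d<s = +-cancelˡ-≤ (bound γ) _ _ (≤-trans (≤-reflexive (+-suc (bound γ) d)) h)

-- Gluing two copies of a piece

∣m-n∣≡o⇒m≡n+o⊎n≡m+o : ∀ m n {o} → ∣ m - n ∣ ≡ o → m ≡ n + o ⊎ n ≡ m + o
∣m-n∣≡o⇒m≡n+o⊎n≡m+o m n refl with ≤-total m n
... | inj₁ m≤n = inj₂ (sym (trans (cong (m +_) (m≤n⇒∣m-n∣≡n∸m m≤n)) (m+[n∸m]≡n m≤n)))
... | inj₂ n≤m = inj₁ (sym (trans (cong (n +_) (m≤n⇒∣n-m∣≡n∸m n≤m)) (m+[n∸m]≡n n≤m)))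

m+q≡p+n⇒∣m-n∣≡∣p-q∣ : ∀ m n p q → m + q ≡ p + n → ∣ m - n ∣ ≡ ∣ p - q ∣
m+q≡p+n⇒∣m-n∣≡∣p-q∣ m n p q eq = begin
  ∣ m - n ∣          ≡⟨ ∣m+n-m+o∣≡∣n-o∣ q m n ⟨
  ∣ q + m - q + n ∣  ≡⟨ cong₂ ∣_-_∣ (trans (+-comm q m) (trans eq (+-comm p n))) (+-comm q n) ⟩
  ∣ n + p - n + q ∣  ≡⟨ ∣m+n-m+o∣≡∣n-o∣ n p q ⟩
  ∣ p - q ∣          ∎
  where open ≡-Reasoning

m+m≡n+n⇒m≡n : ∀ {m n} → m + m ≡ n + n → m ≡ n
m+m≡n+n⇒m≡n {m} {n} eq with <-cmp m n
... | tri< m<n _ _ = contradiction eq (<⇒≢ (+-mono-< m<n m<n))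
... | tri≈ _ m≡n _ = m≡n
... | tri> _ _ n<m = contradiction (sym eq) (<⇒≢ (+-mono-< n<m n<m))

-- In the copy of P glued at a the odd labels are raised by far, in the other copy the
-- even ones are, so a difference d in P becomes far + d in one copy and far - d in the
-- other.  The edge between the two tops gets far itself, and the labels m, …, m + bound
-- left free in between are those of the given graph, whose gaps are smaller.
module _ {A : Set} {E : Rel A 0ℓ} {a : A} (P : Piece) (γ : GracefulOn E) (root0 : label γ a ≡ 0) where

  open Piece P

  private
    ⊤ᴾ : Vertex
    ⊤ᴾ = top tree

    f≤m : ∀ v → f v ≤ m
    f≤m = height≤size tree

    f-top : f ⊤ᴾ ≡ m
    f-top = height-top tree

    -- The least shift for which the smallest new gap, `far - m`, exceeds `bound γ`.
    far : ℕ
    far = suc (m + bound γ)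

    place : Bool → Vertex → ℕ
    place true  v = f v
    place false v = f v + far

    near≢far : ∀ {b} n → b ≤ bound γ → m + b ≢ n + far
    near≢far {b} n b≤ eq = 1+n≰n (≤-trans (m≤n+m far n)
      (≤-trans (≤-reflexive (sym eq)) (+-monoʳ-≤ m b≤)))

    f≢far : ∀ v n → f v ≢ n + far
    f≢far v n eq = 1+n≰n (≤-trans (m≤n+m far n)
      (≤-trans (≤-reflexive (sym eq)) (≤-trans (f≤m v) (m≤m+n m (bound γ)))))

    -- Unraised labels are at most `m` and raised ones at least `far`, which is larger; within
    -- either class `f` is injective.
    place-injective : ∀ b c {u v} → place b u ≡ place c v → b ≡ c × u ≡ v
    place-injective true  true  eq = refl , height-injective tree eq
    place-injective true  false eq = contradiction eq (f≢far _ _)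
    place-injective false true  eq = contradiction (sym eq) (f≢far _ _)
    place-injective false false eq = refl , height-injective tree (+-cancelʳ-≡ far _ _ eq)

    -- Old labels lie from `m` to `m + bound γ`: below all raised ones, and met by an unraised one
    -- only at `m`, the label of the top.
    place≡old : ∀ c {v b} → b ≤ bound γ → m + b ≡ place c v → c ≡ true × v ≡ ⊤ᴾ
    place≡old true {v} {b} b≤ eq = refl , height-injective tree (≤-antisym
      (≤-trans (f≤m v) (≤-reflexive (sym f-top)))
      (≤-trans (≤-reflexive f-top) (≤-trans (m≤m+n m b) (≤-reflexive eq))))
    place≡old false b≤ eq = contradiction eq (near≢far _ b≤)

    ℓ : A ⊎ (Low P ⊎ Vertex) → ℕ
    ℓ (inj₁ x)        = m + label γ x
    ℓ (inj₂ (inj₁ v)) = place (even (value v)) (value v)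
    ℓ (inj₂ (inj₂ v)) = place (not (even v)) v

    ℓ-root : ℓ (inj₁ a) ≡ m
    ℓ-root = trans (cong (m +_) root0) (+-identityʳ m)

    place≤ : ∀ c v → place c v ≤ m + far
    place≤ true  v = ≤-trans (f≤m v) (m≤m+n m far)
    place≤ false v = +-monoˡ-≤ far (f≤m v)

    ℓ≤ : ∀ x → ℓ x ≤ m + far
    ℓ≤ (inj₁ x)        = +-monoʳ-≤ m (≤-trans (label≤bound γ x) (≤-trans (m≤n+m _ m) (n≤1+n _)))
    ℓ≤ (inj₂ (inj₁ v)) = place≤ (even (value v)) (value v)
    ℓ≤ (inj₂ (inj₂ v)) = place≤ (not (even v)) v

    b≢not-b : ∀ {b} → b ≢ not b
    b≢not-b {true}  ()
    b≢not-b {false} ()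

    old≢low : ∀ x (v : Low P) → ℓ (inj₁ x) ≢ ℓ (inj₂ (inj₁ v))
    old≢low x (v ∣ [ v≢top ]) eq = ⊥-elim-irr (v≢top (proj₂ (place≡old (even v) (label≤bound γ x) eq)))

    old≢high : ∀ x v → ℓ (inj₁ x) ≢ ℓ (inj₂ (inj₂ v))
    old≢high x v eq with place≡old (not (even v)) (label≤bound γ x) eq
    -- In the high copy the even vertices are raised, the top among them.
    ... | odd , refl with () ← trans (cong not (sym even-top)) odd

    -- Equal labels force the same vertex and the same flag, while the two copies give a vertex
    -- opposite flags.
    low≢high : ∀ u v → ℓ (inj₂ (inj₁ u)) ≢ ℓ (inj₂ (inj₂ v))
    low≢high u v eq with place-injective (even (value u)) (not (even v)) eq
    ... | p , refl = b≢not-b p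

    ℓ-injective : Injective _≡_ _≡_ ℓ
    ℓ-injective {inj₁ x} {inj₁ y} eq = cong inj₁ (label-injective γ (+-cancelˡ-≡ m _ _ eq))
    ℓ-injective {inj₁ x} {inj₂ (inj₁ v)} eq = contradiction eq (old≢low x v)
    ℓ-injective {inj₁ x} {inj₂ (inj₂ v)} eq = contradiction eq (old≢high x v)
    ℓ-injective {inj₂ (inj₁ u)} {inj₁ x} eq = contradiction (sym eq) (old≢low x u)
    ℓ-injective {inj₂ (inj₁ u)} {inj₂ (inj₁ v)} eq =
      cong (inj₂ ∘′ inj₁) (value-injective (proj₂ (place-injective (even (value u)) (even (value v)) eq)))
    ℓ-injective {inj₂ (inj₁ u)} {inj₂ (inj₂ v)} eq = contradiction eq (low≢high u v)
    ℓ-injective {inj₂ (inj₂ u)} {inj₁ x} eq = contradiction (sym eq) (old≢high x u)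
    ℓ-injective {inj₂ (inj₂ u)} {inj₂ (inj₁ v)} eq = contradiction (sym eq) (low≢high v u)
    ℓ-injective {inj₂ (inj₂ u)} {inj₂ (inj₂ v)} eq =
      cong (inj₂ ∘′ inj₂) (proj₂ (place-injective (not (even u)) (not (even v)) eq))

    f-irreflexive : ∀ {u v} → Edge u v → f u ≢ f v
    f-irreflexive (mkEdge adj _ _) eq = adj-irr (underlying tree) (height-injective tree eq) adj

    -- Long p q b c describes a new edge with end labels b and c, whose gap is
    -- far + q - p.
    data Long : ℕ → ℕ → ℕ → ℕ → Set where
      first  : ∀ {u v} → Edge u v → Long (f u) (f v) (f u) (f v + far)
      second : ∀ {u v} → Edge u v → Long (f v) (f u) (f u + far) (f v)
      joint  : Long m m m (m + far)

    long⇒p≤m : ∀ {p q b c} → Long p q b c → p ≤ m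
    long⇒p≤m (first _)  = f≤m _
    long⇒p≤m (second _) = f≤m _
    long⇒p≤m joint      = ≤-refl

    long-gap : ∀ {p q b c} → Long p q b c → p + ∣ b - c ∣ ≡ q + far
    long-gap l = trans (cong (_ +_) (∣b-c∣ l)) (m+[n∸m]≡n (p≤q+far l))
      where
      p≤q+far : ∀ {p q b c} → Long p q b c → p ≤ q + far
      p≤q+far {q = q} l = ≤-trans (long⇒p≤m l) (≤-trans (m≤m+n m _) (≤-trans (n≤1+n _) (m≤n+m far q)))

      ∣b-c∣ : ∀ {p q b c} → Long p q b c → ∣ b - c ∣ ≡ q + far ∸ p
      ∣b-c∣ l@(first _)  = m≤n⇒∣m-n∣≡n∸m (p≤q+far l)
      ∣b-c∣ l@(second _) = m≤n⇒∣n-m∣≡n∸m (p≤q+far l)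
      ∣b-c∣ l@joint      = m≤n⇒∣m-n∣≡n∸m (p≤q+far l)

    -- Equal gaps mean equal signed differences `p - q`. Within one copy, gracefulness of `P`
    -- identifies the edges. Across the two copies, the edges would be the same edge of `P` with a
    -- difference equal to its own negative, hence zero, and only `joint` has difference zero.
    long-unique : ∀ {p q b c p′ q′ b′ c′} → Long p q b c → Long p′ q′ b′ c′ →
      p + q′ ≡ p′ + q → b ≡ b′ × c ≡ c′
    long-unique (first {u} {v} e) (first {x} {y} e′) eq
      with edge-injective e e′ (m+q≡p+n⇒∣m-n∣≡∣p-q∣ (f u) (f v) (f x) (f y) eq)
    ... | refl , refl = refl , refl
    long-unique (first {u} {v} e) (second {x} {y} e′) eq
      with edge-injective e e′ (trans (m+q≡p+n⇒∣m-n∣≡∣p-q∣ (f u) (f v) (f y) (f x) eq) (∣-∣-comm (f y) (f x)))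
    ... | refl , refl = contradiction (m+m≡n+n⇒m≡n eq) (f-irreflexive e)
    long-unique (first e) joint eq =
      contradiction (+-cancelʳ-≡ m _ _ (trans eq (+-comm m _))) (f-irreflexive e)
    long-unique l@(second _) l′@(first _) eq = Product.map sym sym (long-unique l′ l (sym eq))
    long-unique (second {u} {v} e) (second {x} {y} e′) eq
      with edge-injective e e′ (trans (∣-∣-comm (f u) (f v))
        (trans (m+q≡p+n⇒∣m-n∣≡∣p-q∣ (f v) (f u) (f y) (f x) eq) (∣-∣-comm (f y) (f x))))
    ... | refl , refl = refl , refl
    long-unique (second e) joint eq =
      contradiction (sym (+-cancelʳ-≡ m _ _ (trans eq (+-comm m _)))) (f-irreflexive e)
    long-unique joint joint _ = refl , refl
    long-unique joint l′@(first _) eq = Product.map sym sym (long-unique l′ joint (sym eq))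
    long-unique joint l′@(second _) eq = Product.map sym sym (long-unique l′ joint (sym eq))

    ℓ-low : ∀ {b} (v : Low P) → even (value v) ≡ b → ℓ (inj₂ (inj₁ v)) ≡ place b (value v)
    ℓ-low v eq = cong (λ b → place b (value v)) eq

    ℓ-high : ∀ {b} v → even v ≡ b → ℓ (inj₂ (inj₂ v)) ≡ place (not b) v
    ℓ-high v eq = cong (λ b → place (not b) v) eq

    double⇒long : ∀ {x y} → Double P x y → ∃₂ λ p q → Long p q (ℓ (at a x)) (ℓ (at a y))
    double⇒long (low-top {v} e) = _ , _ ,
      subst₂ (Long _ _) (trans f-top (sym ℓ-root)) (sym (ℓ-low v (Edge.odd-head e))) (first e)
    double⇒long (low {u} {v} e) = _ , _ ,
      subst₂ (Long _ _) (sym (ℓ-low u (Edge.even-tail e))) (sym (ℓ-low v (Edge.odd-head e))) (first e)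
    double⇒long (high {u} {v} e) = _ , _ ,
      subst₂ (Long _ _) (sym (ℓ-high u (Edge.even-tail e))) (sym (ℓ-high v (Edge.odd-head e))) (second e)
    double⇒long tops = _ , _ ,
      subst₂ (Long _ _) (sym ℓ-root) (sym (trans (ℓ-high ⊤ᴾ even-top) (cong (_+ far) f-top))) joint

    -- The even end of an edge of the low copy may be the top, whose place is the glue point;
    -- comparing its label with `m` decides this.
    even⇒at : ∀ u → ∃[ x ] (∀ {v} → Edge u (value v) → Double P x (just (inj₁ v)))
                           × (even u ≡ true → ℓ (at a x) ≡ f u)
    even⇒at u with f u ≟ m
    ... | no  u≢m = just (inj₁ lowU) , low , ℓ-low lowU
      where
      lowU : Low P
      lowU = u ∣ [ (λ eq → u≢m (trans (cong f eq) f-top)) ]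
    ... | yes u≡m with refl ← height-injective tree (trans u≡m (sym f-top)) =
      nothing , low-top , λ _ → trans ℓ-root (sym f-top)

    odd≢top : ∀ {v} → even v ≡ false → v ≢ ⊤ᴾ
    odd≢top odd refl with () ← trans (sym even-top) odd

    long⇒double : ∀ {p q b c} → Long p q b c →
      ∃₂ λ x y → Double P x y × ℓ (at a x) ≡ b × ℓ (at a y) ≡ c
    long⇒double (first {u} {v} e) =
      let (x , edge , eq) = even⇒at u
      in x , just (inj₁ lowV) , edge e , eq (Edge.even-tail e) , ℓ-low lowV (Edge.odd-head e)
      where
      lowV : Low P
      lowV = v ∣ [ odd≢top (Edge.odd-head e) ]
    long⇒double (second {u} {v} e) =
      _ , _ , high e , ℓ-high u (Edge.even-tail e) , ℓ-high v (Edge.odd-head e)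
    long⇒double joint =
      _ , _ , tops , ℓ-root , trans (ℓ-high ⊤ᴾ even-top) (cong (_+ far) f-top)

    -- An edge of `P` with label `d` serves twice: its two copies have signed differences `d` and
    -- `-d`.
    long-exists : ∀ {d} → 1 ≤ d → d ≤ m →
      (∃₂ λ p q → ∃₂ λ b c → Long p q b c × p ≡ q + d) ×
      (∃₂ λ p q → ∃₂ λ b c → Long p q b c × q ≡ p + d)
    long-exists l h =
      let (u , v , e , eq) = edge-surjective l h
      in Sum.[ (λ p → (_ , _ , _ , _ , first e , p) , (_ , _ , _ , _ , second e , p))
             , (λ p → (_ , _ , _ , _ , second e , p) , (_ , _ , _ , _ , first e , p))
             ]′ (∣m-n∣≡o⇒m≡n+o⊎n≡m+o (f u) (f v) eq)

    old-gap : ∀ x y → ∣ ℓ (inj₁ x) - ℓ (inj₁ y) ∣ ≡ gap γ x y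
    old-gap x y = ∣m+n-m+o∣≡∣n-o∣ m _ _

    old-gap≤ : ∀ x y → ∣ ℓ (inj₁ x) - ℓ (inj₁ y) ∣ ≤ bound γ
    old-gap≤ x y = ≤-trans (≤-reflexive (old-gap x y)) (gap≤bound γ x y)

    -- By `long-gap` the gap is `far + q - p`, and `p` is at most `m`, so it is at least `far - m`,
    -- that is, `bound γ + 1`.
    long-gap> : ∀ {p q b c} → Long p q b c → bound γ < ∣ b - c ∣
    long-gap> {q = q} l = ≰⇒> λ gap≤ → 1+n≰n (≤-trans (m≤n+m far q)
      (≤-trans (≤-reflexive (sym (long-gap l))) (+-mono-≤ (long⇒p≤m l) gap≤)))

    inj : ∀ {x y z w} → Join E a (Double P) x y → Join E a (Double P) z w →
      ∣ ℓ x - ℓ y ∣ ≡ ∣ ℓ z - ℓ w ∣ → x ≡ z × y ≡ w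
    inj (old {x} {y} e) (old {z} {w} e′) eq = Product.map (cong inj₁) (cong inj₁)
      (gap-injective γ e e′ (trans (sym (old-gap x y)) (trans eq (old-gap z w))))
    inj (old {x} {y} _) (new d) eq =
      contradiction (≤-trans (≤-reflexive (sym eq)) (old-gap≤ x y))
        (<⇒≱ (long-gap> (proj₂ (proj₂ (double⇒long d)))))
    inj (new d) (old {x} {y} _) eq =
      contradiction (≤-trans (≤-reflexive eq) (old-gap≤ x y))
        (<⇒≱ (long-gap> (proj₂ (proj₂ (double⇒long d)))))
    inj {x} {y} {z} {w} (new d) (new d′) eq =
      let (p , q , l) = double⇒long d
          (p′ , q′ , l′) = double⇒long d′
      in Product.map ℓ-injective ℓ-injective (long-unique l l′ (cross p q p′ q′ (long-gap l)
           (trans (cong (p′ +_) eq) (long-gap l′))))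
      where
      cross : ∀ p q p′ q′ {D} → p + D ≡ q + far → p′ + D ≡ q′ + far → p + q′ ≡ p′ + q
      cross p q p′ q′ {D} e e′ = +-cancelʳ-≡ (D + far) _ _ (begin
        p + q′ + (D + far)     ≡⟨ shuffle p q′ D far ⟩
        p + D + (q′ + far)     ≡⟨ cong₂ _+_ e (sym e′) ⟩
        q + far + (p′ + D)     ≡⟨ shuffle′ p′ q D far ⟩
        p′ + q + (D + far)     ∎)
        where
        open ≡-Reasoning
        shuffle : ∀ a b c d → a + b + (c + d) ≡ a + c + (b + d)
        shuffle = solve-∀
        shuffle′ : ∀ a b c d → b + d + (a + c) ≡ a + b + (c + d)
        shuffle′ = solve-∀

    realise : ∀ {p q b c n} → Long p q b c → p + n ≡ q + far →
      ∃₂ λ x y → Join E a (Double P) x y × ∣ ℓ x - ℓ y ∣ ≡ n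
    realise {p} l eq =
      let (x , y , d , ex , ey) = long⇒double l
      in at a x , at a y , new d ,
         trans (cong₂ ∣_-_∣ ex ey) (+-cancelˡ-≡ p _ _ (trans (long-gap l) (sym eq)))

    -- Beyond the old gaps lie `far - d`, `far` and `far + d`; the bounds on `n` say that `d` is at
    -- most `m`.
    surj-new : ∀ {n} → bound γ < n → n ≤ m + far → Tri (n < far) (n ≡ far) (far < n) →
      ∃₂ λ x y → Join E a (Double P) x y × ∣ ℓ x - ℓ y ∣ ≡ n
    surj-new _ _ (tri≈ _ refl _) = realise joint refl
    surj-new {n} b<n n≤ (tri< n<far _ _) =
      let d≤m = ≤-trans (∸-monoʳ-≤ far b<n) (≤-reflexive (m+n∸n≡m m (bound γ)))
          ((_ , q , _ , _ , l , eq) , _) = long-exists (m<n⇒0<n∸m n<far) d≤m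
      in realise l (trans (cong (_+ n) eq) (trans (+-assoc q _ n) (cong (q +_) (m∸n+n≡m (<⇒≤ n<far)))))
    surj-new b<n n≤ (tri> _ _ far<n) =
      let d≤m = ≤-trans (∸-monoˡ-≤ far n≤) (≤-reflexive (m+n∸n≡m m far))
          (_ , (p , _ , _ , _ , l , eq)) = long-exists (m<n⇒0<n∸m far<n) d≤m
      in realise l (trans (cong (p +_) (sym (m∸n+n≡m (<⇒≤ far<n))))
           (trans (sym (+-assoc p _ far)) (cong (_+ far) (sym eq))))

    surj : ∀ {n} → 1 ≤ n → n ≤ m + far → ∃₂ λ x y → Join E a (Double P) x y × ∣ ℓ x - ℓ y ∣ ≡ n
    surj {n} 1≤n n≤ = Sum.[
        (λ n≤b → let (x , y , e , eq) = gap-surjective γ 1≤n n≤b in _ , _ , old e , trans (old-gap x y) eq)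
      , (λ b<n → surj-new b<n n≤ (<-cmp n far))
      ]′ (≤-<-connex n (bound γ))

    doubled : GracefulOn (Join E a (Double P))
    doubled = record
      { bound           = m + far
      ; label           = ℓ
      ; label≤bound     = ℓ≤
      ; label-injective = ℓ-injective
      ; gap-injective   = inj
      ; gap-surjective  = surj
      }

  -- The top of the high copy is even, hence raised, to `m + far`; this is the bound, which the
  -- complement takes to 0.
  addDouble : RootedGraceful (Join E a (Double P)) (inj₂ (inj₂ (top tree)))
  addDouble = complement doubled , trans
    (cong (m + far ∸_) (trans (ℓ-high ⊤ᴾ even-top) (cong (_+ far) f-top))) (n∸n≡0 (m + far))

-- Locating the root of a lobe

module _ {F : Lobe} where

  private
    T : Graph
    T = lobeGraph F

  root⇝leaf : ∀ {j l n} → Walk T root (leaf j l) n → 2 ≤ n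
  root⇝leaf (fwd () ∷ [])
  root⇝leaf (_ ∷ _ ∷ _) = s≤s (s≤s z≤n)

  -- Leaving the branch at `i` means passing through the root; an excursion to a leaf of the same
  -- arm only adds two steps.
  arm⇝leaf : ∀ {i j l n} → i ≢ j → Walk T (arm i) (leaf j l) n → 3 ≤ n
  arm⇝leaf i≢j (fwd (arm-leaf _ _) ∷ []) = contradiction refl i≢j
  arm⇝leaf i≢j (fwd (arm-leaf _ _) ∷ bwd (arm-leaf _ _) ∷ w) = m≤n⇒m≤o+n 2 (arm⇝leaf i≢j w)
  arm⇝leaf i≢j (bwd (root-arm _) ∷ w) = s≤s (root⇝leaf w)

  leaf⇝leaf : ∀ {i k j l n} → i ≢ j → Walk T (leaf i k) (leaf j l) n → 4 ≤ n
  leaf⇝leaf i≢j [] = contradiction refl i≢j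
  leaf⇝leaf i≢j (bwd (arm-leaf _ _) ∷ w) = s≤s (arm⇝leaf i≢j w)

  -- A lobe has height two, so a walk of four steps without immediate return must have its middle
  -- vertex at the root.
  data FourStep (a b c d e : LobeVertex F) : Set where
    back₁   : a ≡ c → FourStep a b c d e
    back₂   : b ≡ d → FourStep a b c d e
    back₃   : c ≡ e → FourStep a b c d e
    through : ∀ {i j k l} → a ≡ leaf i k → b ≡ arm i → c ≡ root → d ≡ arm j → e ≡ leaf j l →
      FourStep a b c d e

  fourStep : ∀ {a b c d e} → Adj T a b → Adj T b c → Adj T c d → Adj T d e → FourStep a b c d e
  fourStep (fwd (root-arm _))   (bwd (root-arm _))   _                    _                    = back₁ refl
  fourStep (fwd (root-arm _))   (fwd (arm-leaf _ _)) (bwd (arm-leaf _ _)) _                    = back₂ refl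
  fourStep (bwd (root-arm _))   (fwd (root-arm _))   (bwd (root-arm _))   _                    = back₂ refl
  fourStep (bwd (root-arm _))   (fwd (root-arm _))   (fwd (arm-leaf _ _)) (bwd (arm-leaf _ _)) = back₃ refl
  fourStep (fwd (arm-leaf _ _)) (bwd (arm-leaf _ _)) _                    _                    = back₁ refl
  fourStep (bwd (arm-leaf _ _)) (fwd (arm-leaf _ _)) (bwd (arm-leaf _ _)) _                    = back₂ refl
  fourStep (bwd (arm-leaf _ _)) (bwd (root-arm _))   (fwd (root-arm _))   (bwd (root-arm _))   = back₃ refl
  fourStep (bwd (arm-leaf _ _)) (bwd (root-arm _))   (fwd (root-arm _))   (fwd (arm-leaf _ _)) =
    through refl refl refl refl refl

-- Embeddings as induced subgraphs: `adj⁻` pulls adjacencies seen in a lobe back to `G`.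
record _↪_ (G H : Graph) : Set where
  field
    to        : V G → V H
    injective : Injective _≡_ _≡_ to
    adj       : ∀ {u v} → Adj G u v → Adj H (to u) (to v)
    adj⁻      : ∀ {u v} → Adj H (to u) (to v) → Adj G u v

module _ {F : Lobe} {G : Graph} (φ : G ↪ lobeGraph F) (connected : Connected G) where

  open _↪_ φ

  private
    mapWalk : ∀ {u v n} → Walk G u v n → Walk (lobeGraph F) (to u) (to v) n
    mapWalk []      = []
    mapWalk (a ∷ w) = adj a ∷ mapWalk w

    -- Each case records edges of `G` leading from `x` to `z`, the vertex over the root; they bound
    -- the distances from `z`.
    data View (z x : V G) : Set where
      is-root : x ≡ z → View z x
      is-arm  : ∀ {j} → to x ≡ arm j → Adj G x z → View z x
      is-leaf : ∀ {j l y} → to x ≡ leaf j l → Adj G x y → Adj G y z → View z x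

    view : ∀ {z} → to z ≡ root → ∀ x → View z x
    view {z} z≡ x with to x in eq
    ... | root     = is-root (injective (trans eq (sym z≡)))
    ... | arm j    = is-arm eq (adj⁻ (subst₂ (Adj (lobeGraph F)) (sym eq) (sym z≡) (bwd (root-arm j))))
    -- A leaf has its arm as sole neighbour, so the first step of any walk from `x` to `z` supplies
    -- a vertex over that arm.
    ... | leaf j l with connected x z
    ...   | _ , [] with () ← trans (sym eq) z≡
    ...   | _ , _∷_ {v = y} a _ =
      is-leaf eq a (adj⁻ (subst₂ (Adj (lobeGraph F)) (sym y≡arm) (sym z≡) (bwd (root-arm j))))
      where
      toward : ∀ {t} → Adj (lobeGraph F) (leaf j l) t → t ≡ arm j
      toward (bwd (arm-leaf _ _)) = refl

      y≡arm : to y ≡ arm j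
      y≡arm = toward (subst (λ t → Adj (lobeGraph F) t (to y)) eq (adj a))

    walkTo : ∀ {u v n a b} → to u ≡ a → to v ≡ b → Walk G u v n → Walk (lobeGraph F) a b n
    walkTo refl refl = mapWalk

  -- A shortest walk realizing the diameter never turns back, so its middle `z` lies over the root
  -- and has eccentricity 2. Any other vertex lies outside the branch of one of the two ends and has
  -- distance at least 3 to that end.
  central⇒root : Diameter G 4 → ∀ {c} → IsCentral G c → to c ≡ root
  central⇒root ((u , v , (_∷_ {v = x} a (_∷_ {v = z} b (_∷_ {v = y} d (e ∷ [])))) , shortest) , _)
               {c} (ecc , ecc-c , least)
    with fourStep (adj a) (adj b) (adj d) (adj e)
  -- Cutting out a return leaves a walk of length two between vertices at distance four.
  ... | back₁ eq with refl ← injective eq = contradiction (shortest (d ∷ e ∷ [])) λ { (s≤s (s≤s ())) }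
  ... | back₂ eq with refl ← injective eq = contradiction (shortest (a ∷ e ∷ [])) λ { (s≤s (s≤s ())) }
  ... | back₃ eq with refl ← injective eq = contradiction (shortest (a ∷ b ∷ [])) λ { (s≤s (s≤s ())) }
  ... | through {i} {j} u≡ x≡ z≡ y≡ v≡ = located (view z≡ c)
    where
    i≢j : i ≢ j
    i≢j refl with refl ← injective (trans x≡ (sym y≡)) =
      contradiction (shortest (a ∷ e ∷ [])) λ { (s≤s (s≤s ())) }

    a⁻ : Adj G x u
    a⁻ = adj-sym G a

    b⁻ : Adj G z x
    b⁻ = adj-sym G b

    near : ∀ w → View z w → ∀ {n} → Distance G z w n → n ≤ 2
    near _ (is-root refl)    (_ , min) = ≤-trans (min []) z≤n
    near _ (is-arm _ f)      (_ , min) = ≤-trans (min (adj-sym G f ∷ [])) (s≤s z≤n)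
    near _ (is-leaf _ f g)   (_ , min) = min (adj-sym G g ∷ adj-sym G f ∷ [])

    ecc≤2 : ecc ≤ 2
    ecc≤2 = least ((u , b⁻ ∷ a⁻ ∷ [] , λ w → root⇝leaf (walkTo z≡ u≡ w)) , near _ (view z≡ _))

    too-far : ∀ {w n} → Distance G c w (3 + n) → ⊥
    too-far dist with s≤s (s≤s ()) ← ≤-trans (proj₂ ecc-c dist) ecc≤2

    located : View z c → to c ≡ root
    located (is-root refl) = z≡
    located (is-arm {k} c≡ f) with k Fin.≟ i
    ... | no  k≢i  = ⊥-elim (too-far (f ∷ b⁻ ∷ a⁻ ∷ [] , λ w → arm⇝leaf k≢i (walkTo c≡ u≡ w)))
    ... | yes refl = ⊥-elim (too-far (f ∷ d ∷ e ∷ [] , λ w → arm⇝leaf i≢j (walkTo c≡ v≡ w)))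
    located (is-leaf {k} c≡ f g) with k Fin.≟ i
    ... | no  k≢i  = ⊥-elim (too-far (f ∷ g ∷ b⁻ ∷ a⁻ ∷ [] , λ w → leaf⇝leaf k≢i (walkTo c≡ u≡ w)))
    ... | yes refl = ⊥-elim (too-far (f ∷ g ∷ d ∷ e ∷ [] , λ w → leaf⇝leaf i≢j (walkTo c≡ v≡ w)))

-- Lobes and the spine as one-point unions

-- A bijection of vertices under which `E` gives the edges of `G`, each in at least one direction,
-- possibly in both.
record Oriented (G : Graph) {A : Set} (E : Rel A 0ℓ) : Set where
  field
    to       : V G → A
    from     : A → V G
    from∘to  : ∀ v → from (to v) ≡ v
    to∘from  : ∀ a → to (from a) ≡ a
    to-adj   : ∀ {u v} → Adj G u v → E (to u) (to v) ⊎ E (to v) (to u)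
    from-adj : ∀ {a b} → E a b → Adj G (from a) (from b)

  to-injective : Injective _≡_ _≡_ to
  to-injective eq = trans (sym (from∘to _)) (trans (cong from eq) (from∘to _))

module ReducedLobe {F : Lobe} {T : Graph} (ι : reducedLobe F ≅ T) where

  private
    module I = Inverse (_≅_.bij ι)

    keep : (x : LobeVertex F) → .(¬ Pendant F x) → V T
    keep x p = I.to (x ∣ [ p ])

    pendants : List (Fin (arms F))
    pendants = filter (λ j → leaves F j ≟ 0) (allFin (arms F))

    pendants-unique : Unique pendants
    pendants-unique = filter⁺ _ (allFin⁺ _)

    -- Other arms survive in the reduced lobe; pendant ones become rays, numbered by position in
    -- `pendants`. Passing the decision as an argument lets proofs split on it.
    toArm : ∀ j → Dec (leaves F j ≡ 0) → V T ⊎ Fin (length pendants)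
    toArm j (yes k≡0) = inj₂ (index (∈-filter⁺ (λ j → leaves F j ≟ 0) (∈-allFin j) k≡0))
    toArm j (no k≢0)  = inj₁ (keep (arm j) λ { (pendant k≡0) → k≢0 k≡0 })

    to : LobeVertex F → V T ⊎ Fin (length pendants)
    to root       = inj₁ (keep root λ ())
    to (arm j)    = toArm j (leaves F j ≟ 0)
    to (leaf j l) = inj₁ (keep (leaf j l) λ ())

    from : V T ⊎ Fin (length pendants) → LobeVertex F
    from (inj₁ t) = value (I.from t)
    from (inj₂ k) = arm (lookup pendants k)

    from-keep : ∀ x .(p : ¬ Pendant F x) → value (I.from (keep x p)) ≡ x
    from-keep x p = cong value (I.inverseʳ refl)

    from∘toArm : ∀ j d → from (toArm j d) ≡ arm j
    from∘toArm j (yes k≡0) = cong arm (sym (lookup-index (∈-filter⁺ (λ j → leaves F j ≟ 0) (∈-allFin j) k≡0)))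
    from∘toArm j (no _)    = from-keep (arm j) _

    toArm-lookup : ∀ k d → toArm (lookup pendants k) d ≡ inj₂ k
    toArm-lookup k (yes k≡0) = cong inj₂ (lookup-injective pendants-unique
      (sym (lookup-index (∈-filter⁺ (λ j → leaves F j ≟ 0) (∈-allFin _) k≡0))))
    toArm-lookup k (no k≢0)  =
      contradiction (proj₂ (∈-filter⁻ (λ j → leaves F j ≟ 0) {xs = allFin (arms F)} (∈-lookup k))) k≢0

    toArm-keep : ∀ j d .(p : ¬ Pendant F (arm j)) → toArm j d ≡ inj₁ (keep (arm j) p)
    toArm-keep j (yes k≡0) p = ⊥-elim-irr (p (pendant k≡0))
    toArm-keep j (no _)    p = refl

    to-keep : ∀ x .(p : ¬ Pendant F x) → to x ≡ inj₁ (keep x p)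
    to-keep root       p = refl
    to-keep (arm j)    p = toArm-keep j _ p
    to-keep (leaf j l) p = refl

    to-value : ∀ w → to (value w) ≡ inj₁ (I.to w)
    to-value (x ∣ [ p ]) = to-keep x p

    adj⁺ : ∀ {x y} .{p q} → LobeEdge F x y → Adj T (keep x p) (keep y q)
    adj⁺ e = Equivalence.to (_≅_.adj⇔adj ι _ _) (fwd e)

  pendantCount : ℕ
  pendantCount = length pendants

  centre : V T
  centre = keep root λ ()

  oriented : Oriented (lobeGraph F) (Join (Adj T) centre (Star pendantCount))
  oriented = record
    { to       = to
    ; from     = from
    ; from∘to  = λ { root       → from-keep root _
                   ; (arm j)    → from∘toArm j (leaves F j ≟ 0)
                   ; (leaf j l) → from-keep (leaf j l) _ }
    ; to∘from  = λ { (inj₁ t) → trans (to-value (I.from t)) (cong inj₁ (I.inverseˡ refl))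
                   ; (inj₂ k) → toArm-lookup k _ }
    ; to-adj   = λ { (fwd e) → inj₁ (edge e) ; (bwd e) → inj₂ (edge e) }
    ; from-adj = λ { (old {x} {y} a) → Equivalence.from (_≅_.adj⇔adj ι _ _)
                       (subst₂ (Adj T) (sym (I.inverseˡ refl)) (sym (I.inverseˡ refl)) a)
                   ; (new (ray k)) → subst (λ r → Adj (lobeGraph F) r (arm (lookup pendants k)))
                       (sym (from-keep root _)) (fwd (root-arm _)) }
    }
    where
    edgeToArm : ∀ j d → Join (Adj T) centre (Star pendantCount) (to root) (toArm j d)
    edgeToArm j (yes _) = new (ray _)
    edgeToArm j (no _)  = old (adj⁺ (root-arm j))

    edge : ∀ {x y} → LobeEdge F x y → Join (Adj T) centre (Star pendantCount) (to x) (to y)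
    edge (root-arm j)   = edgeToArm j _
    edge (arm-leaf j l) = subst (λ t → Join (Adj T) centre (Star pendantCount) t (to (leaf j l)))
      (sym (to-keep (arm j) not-pendant)) (old (adj⁺ (arm-leaf j l)))
      where
      not-pendant : ¬ Pendant F (arm j)
      not-pendant (pendant k≡0) with () ← subst Fin k≡0 l

  restrict : ∀ {G} → G ↪ T → G ↪ lobeGraph F
  restrict ε = record
    { to        = λ v → value (I.from (E.to v))
    ; injective = λ eq → E.injective
        (trans (sym (I.inverseˡ refl)) (trans (cong I.to (value-injective eq)) (I.inverseˡ refl)))
    ; adj       = λ a → Equivalence.from (_≅_.adj⇔adj ι _ _)
        (subst₂ (Adj T) (sym (I.inverseˡ refl)) (sym (I.inverseˡ refl)) (E.adj a))
    ; adj⁻      = λ a → E.adj⁻ (subst₂ (Adj T) (I.inverseˡ refl) (I.inverseˡ refl)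
        (Equivalence.to (_≅_.adj⇔adj ι _ _) a))
    }
    where module E = _↪_ ε

  restrict≡root : ∀ {G} (ε : G ↪ T) {v} → _↪_.to (restrict ε) v ≡ root → centre ≡ _↪_.to ε v
  restrict≡root ε eq = trans (cong I.to (value-injective (sym eq))) (I.inverseˡ refl)

-- The layers of the spine

-- One step along the spine: `s` rays and a double of `P` at the glue point, and all later layers
-- `D` at the top of the high copy.
data Layer {R : Set} (s : ℕ) (P : Piece) (D : Rel (Maybe R) 0ℓ) :
           Rel (Maybe ((Fin s ⊎ (Low P ⊎ Piece.Vertex P)) ⊎ R)) 0ℓ where
  ray    : ∀ k → Layer s P D nothing (just (inj₁ (inj₁ k)))
  double : ∀ {x y} → Double P x y →
    Layer s P D (Maybe.map (inj₁ ∘′ inj₂) x) (Maybe.map (inj₁ ∘′ inj₂) y)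
  rest   : ∀ {x y} → D x y →
    Layer s P D (just (Sum.map₁ (inj₂ ∘′ inj₂) (at (top (Piece.tree P)) x)))
                (just (Sum.map₁ (inj₂ ∘′ inj₂) (at (top (Piece.tree P)) y)))

-- The vertices of the spine lobe graph outside the copy of P 0 in the first lobe.
Rest : ∀ p → (Fin (suc p) → Piece) → (Fin (suc p) → ℕ) → Set
Rest zero    P s = Fin (s zero)
Rest (suc p) P s =
  (Fin (s zero) ⊎ (Low (P (suc zero)) ⊎ Piece.Vertex (P (suc zero)))) ⊎ Rest p (P ∘′ suc) (s ∘′ suc)

RestEdge : ∀ p P s → Rel (Maybe (Rest p P s)) 0ℓ
RestEdge zero    P s = Star (s zero)
RestEdge (suc p) P s = Layer (s zero) (P (suc zero)) (RestEdge p (P ∘′ suc) (s ∘′ suc))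

module _ {A R : Set} {E : Rel A 0ℓ} {a : A} {s : ℕ} {P : Piece} {D : Rel (Maybe R) 0ℓ} where

  private
    Inner : Rel ((A ⊎ Fin s) ⊎ (Low P ⊎ Piece.Vertex P)) 0ℓ
    Inner = Join (Join E a (Star s)) (inj₁ a) (Double P)

    apex : (A ⊎ Fin s) ⊎ (Low P ⊎ Piece.Vertex P)
    apex = inj₂ (inj₂ (top (Piece.tree P)))

    assoc : A ⊎ ((Fin s ⊎ (Low P ⊎ Piece.Vertex P)) ⊎ R) →
            ((A ⊎ Fin s) ⊎ (Low P ⊎ Piece.Vertex P)) ⊎ R
    assoc (inj₁ x)                      = inj₁ (inj₁ (inj₁ x))
    assoc (inj₂ (inj₁ (inj₁ k)))        = inj₁ (inj₁ (inj₂ k))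
    assoc (inj₂ (inj₁ (inj₂ v)))        = inj₁ (inj₂ v)
    assoc (inj₂ (inj₂ r))               = inj₂ r

    assoc⁻ : ((A ⊎ Fin s) ⊎ (Low P ⊎ Piece.Vertex P)) ⊎ R →
             A ⊎ ((Fin s ⊎ (Low P ⊎ Piece.Vertex P)) ⊎ R)
    assoc⁻ (inj₁ (inj₁ (inj₁ x))) = inj₁ x
    assoc⁻ (inj₁ (inj₁ (inj₂ k))) = inj₂ (inj₁ (inj₁ k))
    assoc⁻ (inj₁ (inj₂ v))        = inj₂ (inj₁ (inj₂ v))
    assoc⁻ (inj₂ r)               = inj₂ (inj₂ r)

    assoc⁻∘assoc : ∀ x → assoc⁻ (assoc x) ≡ x
    assoc⁻∘assoc (inj₁ x)               = refl
    assoc⁻∘assoc (inj₂ (inj₁ (inj₁ k))) = refl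
    assoc⁻∘assoc (inj₂ (inj₁ (inj₂ v))) = refl
    assoc⁻∘assoc (inj₂ (inj₂ r))        = refl

    assoc-double : ∀ x → assoc (at a (Maybe.map (inj₁ ∘′ inj₂) x)) ≡ inj₁ (at (inj₁ a) x)
    assoc-double nothing  = refl
    assoc-double (just _) = refl

    assoc-rest : ∀ x → assoc (inj₂ (Sum.map₁ (inj₂ ∘′ inj₂) (at (top (Piece.tree P)) x))) ≡ at apex x
    assoc-rest nothing  = refl
    assoc-rest (just _) = refl

  -- Gluing is associative: attaching the star, the double and the later layers one by one amounts
  -- to attaching the whole layer.
  regroup : GracefulOn (Join Inner apex D) → GracefulOn (Join E a (Layer s P D))
  regroup = transport assoc assoc-injective hom lift
    where
    assoc-injective : Injective _≡_ _≡_ assoc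
    assoc-injective eq = trans (sym (assoc⁻∘assoc _)) (trans (cong assoc⁻ eq) (assoc⁻∘assoc _))

    hom : ∀ {x y} → Join E a (Layer s P D) x y → Join Inner apex D (assoc x) (assoc y)
    hom (old e) = old (old (old e))
    hom (new (ray k)) = old (old (new (ray k)))
    hom (new (double {x} {y} d)) =
      subst₂ (Join Inner apex D) (sym (assoc-double x)) (sym (assoc-double y)) (old (new d))
    hom (new (rest {x} {y} d)) =
      subst₂ (Join Inner apex D) (sym (assoc-rest x)) (sym (assoc-rest y)) (new d)

    lift : ∀ {b c} → Join Inner apex D b c →
      ∃₂ λ x y → Join E a (Layer s P D) x y × assoc x ≡ b × assoc y ≡ c
    lift (old (old (old e)))       = _ , _ , old e , refl , refl
    lift (old (old (new (ray k)))) = _ , _ , new (ray k) , refl , refl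
    lift (old (new {x} {y} d))     = _ , _ , new (double d) , assoc-double x , assoc-double y
    lift (new {x} {y} d)           = _ , _ , new (rest d) , assoc-rest x , assoc-rest y

-- Induction on the number of layers with `E` arbitrary: each layer is absorbed into the graph
-- already labeled, and the root moves to the next spine vertex.
rest-graceful : ∀ p P s {A : Set} {E : Rel A 0ℓ} {a} → RootedGraceful E a →
  GracefulOn (Join E a (RestEdge p P s))
rest-graceful zero    P s γ = proj₁ (addStar (s zero) γ)
rest-graceful (suc p) P s γ =
  let (star , root0) = addStar (s zero) γ
  in regroup (rest-graceful p _ _ (addDouble (P (suc zero)) star root0))

-- Linked lobes

depthEven : ∀ {F} → LobeVertex F → Bool
depthEven root       = true
depthEven (arm _)    = false
depthEven (leaf _ _) = true

depthEven-adj : ∀ {F x y} → Adj (lobeGraph F) x y → depthEven y ≡ not (depthEven x)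
depthEven-adj (fwd (root-arm _))   = refl
depthEven-adj (fwd (arm-leaf _ _)) = refl
depthEven-adj (bwd (root-arm _))   = refl
depthEven-adj (bwd (arm-leaf _ _)) = refl

colour : ∀ {G F} (φ : underlying G ↪ lobeGraph F) → _↪_.to φ (top G) ≡ root → Colouring G
colour φ top≡root = record
  { even     = depthEven ∘′ _↪_.to φ
  ; even-top = cong depthEven top≡root
  ; even-adj = depthEven-adj ∘′ _↪_.adj φ
  }

-- The linking data without the lobster, indexed by `p`, so that dropping the first lobe gives data
-- of the same kind.
record LinkedLobes (p : ℕ) : Set₁ where
  field
    lobe        : Fin (suc p) → Lobe
    linkTree    : Fin (suc p) → LinkTree
    linked      : ∀ (i : Fin p) → reducedLobe (lobe (inject₁ i)) ≅
                    (labeled (linkTree (inject₁ i)) ∘ labeled (linkTree (suc i)))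
    linked-last : reducedLobe (lobe (fromℕ p)) ≅ underlying (labeled (linkTree (fromℕ p)))

  tree : Fin (suc p) → GracefullyLabeled
  tree i = labeled (linkTree i)

  spine : Graph
  spine = spineLobeGraph lobe

open LinkedLobes

tail : ∀ {p} → LinkedLobes (suc p) → LinkedLobes p
tail C = record
  { lobe        = lobe C ∘′ suc
  ; linkTree    = linkTree C ∘′ suc
  ; linked      = linked C ∘′ suc
  ; linked-last = linked-last C
  }

id↪ : ∀ {G} → G ↪ G
id↪ = record { to = id ; injective = id ; adj = id ; adj⁻ = id }

inj₁↪ : ∀ G H → underlying G ↪ (G ∘ H)
inj₁↪ G H = record { to = inj₁ ; injective = inj₁-injective ; adj = id ; adj⁻ = id }

-- The last reduced lobe is a copy of the tree itself; an earlier one contains it as the first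
-- factor of `_∘_`.
headEmbedding : ∀ {p} (C : LinkedLobes p) → underlying (tree C zero) ↪ lobeGraph (lobe C zero)
headEmbedding {zero}  C = ReducedLobe.restrict (linked-last C) id↪
headEmbedding {suc p} C = ReducedLobe.restrict (linked C zero) (inj₁↪ (tree C zero) (tree C (suc zero)))

headEmbedding-top : ∀ {p} (C : LinkedLobes p) → _↪_.to (headEmbedding C) (top (tree C zero)) ≡ root
headEmbedding-top C = central⇒root (headEmbedding C) (IsTree.connected isTree) diameter-4 top-central
  where open LinkTree (linkTree C zero)

-- Each tree becomes the head of the chain once the lobes before its own are dropped.
colourings : ∀ {p} (C : LinkedLobes p) i → Colouring (tree C i)
colourings         C zero    = colour (headEmbedding C) (headEmbedding-top C)
colourings {suc p} C (suc i) = colourings (tail C) i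

pieces : ∀ {p} → LinkedLobes p → Fin (suc p) → Piece
pieces C i = record { tree = tree C i ; colouring = colourings C i }

counts : ∀ {p} → LinkedLobes p → Fin (suc p) → ℕ
counts {zero}  C zero    = ReducedLobe.pendantCount (linked-last C)
counts {suc p} C zero    = ReducedLobe.pendantCount (linked C zero)
counts {suc p} C (suc i) = counts (tail C) i

-- The spine lobe graph as an iterated union

SpineEdge : ∀ {p} (C : LinkedLobes p) →
  Rel (V (underlying (tree C zero)) ⊎ Rest p (pieces C) (counts C)) 0ℓ
SpineEdge {p} C = Join (Piece.Edge (pieces C zero)) (top (tree C zero)) (RestEdge p (pieces C) (counts C))

-- `to-root` is carried through the induction because the edge from the preceding spine vertex ends
-- at this root.
record OrientedSpine {p} (C : LinkedLobes p) : Set where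
  field
    oriented : Oriented (spine C) (SpineEdge C)
    to-root  : Oriented.to oriented (zero , root) ≡ inj₁ (top (tree C zero))

module OneLobe (C : LinkedLobes 0) where

  private
    P = pieces C zero
    open module R = ReducedLobe (linked-last C)
    open module O = Oriented R.oriented

    centre≡top : centre ≡ top (tree C zero)
    centre≡top = restrict≡root id↪ (headEmbedding-top C)

    HeadEdge : Rel (Piece.Vertex P ⊎ Fin pendantCount) 0ℓ
    HeadEdge = Join (Adj (underlying (tree C zero))) centre (Star pendantCount)

    to-edge : ∀ {a b} → HeadEdge a b → SpineEdge C a b ⊎ SpineEdge C b a
    to-edge (old a) = Sum.map old old (Piece.orient P a)
    to-edge (new (ray k)) rewrite centre≡top = inj₁ (new (ray k))

    from-edge : ∀ {a b} → SpineEdge C a b → HeadEdge a b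
    from-edge (old e) = old (Piece.Edge.adj e)
    from-edge (new (ray k)) =
      subst (λ t → HeadEdge (inj₁ t) (inj₂ k)) centre≡top (new (ray k))

  orientedSpine : OrientedSpine C
  orientedSpine = record
    { oriented = record
      { to       = λ { (zero , x) → O.to x }
      ; from     = λ a → zero , O.from a
      ; from∘to  = λ { (zero , x) → cong (zero ,_) (O.from∘to x) }
      ; to∘from  = O.to∘from
      ; to-adj   = λ { (in-lobe {zero} e) → Sum.[ to-edge , Sum.swap ∘′ to-edge ]′ (O.to-adj e)
                     ; (on-spine {zero} {zero} (fwd ()))
                     ; (on-spine {zero} {zero} (bwd ())) }
      ; from-adj = λ e → in-lobe (O.from-adj (from-edge e))
      }
    ; to-root = cong inj₁ centre≡top
    }

module ManyLobes {p} (C : LinkedLobes (suc p)) (S : OrientedSpine (tail C)) where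

  private
    P₀ = pieces C zero
    P₁ = pieces C (suc zero)
    ⊤₀ = top (tree C zero)
    ⊤₁ = top (tree C (suc zero))
    R′ = Rest p (pieces (tail C)) (counts (tail C))
    open module R = ReducedLobe (linked C zero)
    module O = Oriented R.oriented
    module S′ = Oriented (OrientedSpine.oriented S)

    Head : Set
    Head = (Piece.Vertex P₀ ⊎ Low P₁) ⊎ Fin pendantCount

    HeadEdge : Rel Head 0ℓ
    HeadEdge = Join (Adj (tree C zero ∘ tree C (suc zero))) centre (Star pendantCount)

    Whole : Set
    Whole = Piece.Vertex P₀ ⊎ ((Fin pendantCount ⊎ (Low P₁ ⊎ Piece.Vertex P₁)) ⊎ R′)

    centre≡top : centre ≡ inj₁ ⊤₀
    centre≡top = restrict≡root (inj₁↪ (tree C zero) (tree C (suc zero))) (headEmbedding-top C)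

    -- The first lobe covers the head piece, the rays and the low copy of `P₁`; the high copy and
    -- everything beyond it come from the later lobes through `τ`.
    σ : Head → Whole
    σ (inj₁ (inj₁ u)) = inj₁ u
    σ (inj₁ (inj₂ v)) = inj₂ (inj₁ (inj₂ (inj₁ v)))
    σ (inj₂ k)        = inj₂ (inj₁ (inj₁ k))

    τ : Piece.Vertex P₁ ⊎ R′ → Whole
    τ x = inj₂ (Sum.map₁ (inj₂ ∘′ inj₂) x)

    shift : V (spine (tail C)) → V (spine C)
    shift (i , x) = suc i , x

    shift-adj : ∀ {u v} → Adj (spine (tail C)) u v → Adj (spine C) (shift u) (shift v)
    shift-adj (in-lobe e)        = in-lobe e
    shift-adj (on-spine (fwd e)) = on-spine (fwd (cong suc e))
    shift-adj (on-spine (bwd e)) = on-spine (bwd (cong suc e))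

    to : V (spine C) → Whole
    to (zero  , x) = σ (O.to x)
    to (suc i , x) = τ (S′.to (i , x))

    from : Whole → V (spine C)
    from (inj₁ u)                      = zero , O.from (inj₁ (inj₁ u))
    from (inj₂ (inj₁ (inj₁ k)))        = zero , O.from (inj₂ k)
    from (inj₂ (inj₁ (inj₂ (inj₁ v)))) = zero , O.from (inj₁ (inj₂ v))
    from (inj₂ (inj₁ (inj₂ (inj₂ v)))) = shift (S′.from (inj₁ v))
    from (inj₂ (inj₂ r))               = shift (S′.from (inj₂ r))

    from-σ : ∀ x → from (σ x) ≡ (zero , O.from x)
    from-σ (inj₁ (inj₁ u)) = refl
    from-σ (inj₁ (inj₂ v)) = refl
    from-σ (inj₂ k)        = refl

    from-τ : ∀ x → from (τ x) ≡ shift (S′.from x)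
    from-τ (inj₁ v) = refl
    from-τ (inj₂ r) = refl

    to-σ : ∀ x → to (zero , O.from x) ≡ σ x
    to-σ x = cong σ (O.to∘from x)

    to-τ : ∀ x → to (shift (S′.from x)) ≡ τ x
    to-τ x = cong τ (S′.to∘from x)

    σ-edge : ∀ {a b} → HeadEdge a b → SpineEdge C (σ a) (σ b) ⊎ SpineEdge C (σ b) (σ a)
    σ-edge (old {inj₁ u} {inj₁ v} a)          = Sum.map old old (Piece.orient P₀ a)
    -- At the glue point of `_∘_`, the edges of the second tree are those at the top of the low
    -- copy.
    σ-edge (old {inj₁ u} {inj₂ v} (refl , a)) = inj₁ (new (double (low-top (Piece.orient-top P₁ a))))
    σ-edge (old {inj₂ u} {inj₁ v} (refl , a)) =
      inj₂ (new (double (low-top (Piece.orient-top P₁ (adj-sym (underlying (tree C (suc zero))) a)))))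
    σ-edge (old {inj₂ u} {inj₂ v} a)          =
      Sum.map (λ e → new (double (low e))) (λ e → new (double (low e))) (Piece.orient P₁ a)
    σ-edge (new (ray k)) =
      inj₁ (subst (λ t → SpineEdge C (σ (inj₁ t)) (σ (inj₂ k))) (sym centre≡top) (new (ray k)))

    τ-edge : ∀ {a b} → SpineEdge (tail C) a b → SpineEdge C (τ a) (τ b)
    τ-edge (old e) = new (double (high e))
    τ-edge (new e) = new (rest e)

    to-root : to (zero , root) ≡ inj₁ ⊤₀
    to-root = cong (σ ∘′ inj₁) centre≡top

    to-root′ : to (suc zero , root) ≡ τ (inj₁ ⊤₁)
    to-root′ = cong τ (OrientedSpine.to-root S)

    tops-edge : SpineEdge C (to (zero , root)) (to (suc zero , root))
    tops-edge = subst₂ (SpineEdge C) (sym to-root) (sym to-root′) (new (double tops))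

    to-adj : ∀ {u v} → Adj (spine C) u v → SpineEdge C (to u) (to v) ⊎ SpineEdge C (to v) (to u)
    to-adj (in-lobe {zero} e)  = Sum.[ σ-edge , Sum.swap ∘′ σ-edge ]′ (O.to-adj e)
    to-adj (in-lobe {suc i} e) = Sum.map τ-edge τ-edge (S′.to-adj (in-lobe e))
    to-adj (on-spine {zero} {zero} (fwd ()))
    to-adj (on-spine {zero} {zero} (bwd ()))
    -- The first spine edge is the edge `tops` of the double.
    to-adj (on-spine {zero} {suc zero} _) = inj₁ tops-edge
    to-adj (on-spine {zero} {suc (suc _)} (fwd ()))
    to-adj (on-spine {zero} {suc (suc _)} (bwd ()))
    to-adj (on-spine {suc zero} {zero} _) = inj₂ tops-edge
    to-adj (on-spine {suc (suc _)} {zero} (fwd ()))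
    to-adj (on-spine {suc (suc _)} {zero} (bwd ()))
    to-adj (on-spine {suc i} {suc j} (fwd e)) =
      Sum.map τ-edge τ-edge (S′.to-adj (on-spine (fwd (suc-injective e))))
    to-adj (on-spine {suc i} {suc j} (bwd e)) =
      Sum.map τ-edge τ-edge (S′.to-adj (on-spine (bwd (suc-injective e))))

    from-root : from (inj₁ ⊤₀) ≡ (zero , root)
    from-root = cong (zero ,_) (trans (cong (O.from ∘′ inj₁) (sym centre≡top)) (O.from∘to root))

    from-root′ : from (τ (inj₁ ⊤₁)) ≡ (suc zero , root)
    from-root′ = cong shift (trans (cong S′.from (sym (OrientedSpine.to-root S))) (S′.from∘to (zero , root)))

    head-adj : ∀ {a b} → HeadEdge a b → Adj (spine C) (zero , O.from a) (zero , O.from b)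
    head-adj e = in-lobe (O.from-adj e)

    from-adj : ∀ {a b} → SpineEdge C a b → Adj (spine C) (from a) (from b)
    from-adj (old e) = head-adj (old (Piece.Edge.adj e))
    from-adj (new (ray k)) =
      head-adj (subst (λ t → HeadEdge (inj₁ t) (inj₂ k)) centre≡top (new (ray k)))
    from-adj (new (double (low-top e))) = head-adj (old (refl , Piece.Edge.adj e))
    from-adj (new (double (low e)))     = head-adj (old (Piece.Edge.adj e))
    from-adj (new (double (high e)))    = shift-adj (S′.from-adj (old e))
    from-adj (new (double tops))        =
      subst₂ (Adj (spine C)) (sym from-root) (sym from-root′) (on-spine (fwd refl))
    from-adj (new (rest {x} {y} e))     =
      subst₂ (Adj (spine C)) (sym (from-τ (at ⊤₁ x))) (sym (from-τ (at ⊤₁ y)))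
        (shift-adj (S′.from-adj (new e)))

  orientedSpine : OrientedSpine C
  orientedSpine = record
    { oriented = record
      { to       = to
      ; from     = from
      ; from∘to  = λ { (zero , x)  → trans (from-σ (O.to x)) (cong (zero ,_) (O.from∘to x))
                     ; (suc i , x) → trans (from-τ (S′.to (i , x))) (cong shift (S′.from∘to (i , x))) }
      ; to∘from  = λ { (inj₁ u)                      → to-σ (inj₁ (inj₁ u))
                     ; (inj₂ (inj₁ (inj₁ k)))        → to-σ (inj₂ k)
                     ; (inj₂ (inj₁ (inj₂ (inj₁ v)))) → to-σ (inj₁ (inj₂ v))
                     ; (inj₂ (inj₁ (inj₂ (inj₂ v)))) → to-τ (inj₁ v)
                     ; (inj₂ (inj₂ r))               → to-τ (inj₂ r) }
      ; to-adj   = to-adj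
      ; from-adj = from-adj
      }
    ; to-root = to-root
    }

orientedSpine : ∀ {p} (C : LinkedLobes p) → OrientedSpine C
orientedSpine {zero}  C = OneLobe.orientedSpine C
orientedSpine {suc p} C = ManyLobes.orientedSpine C (orientedSpine (tail C))

oriented-≅ : ∀ {G H : Graph} {A : Set} {E : Rel A 0ℓ} → G ≅ H → Oriented H E → Oriented G E
oriented-≅ {H = H} ι o = record
  { to       = λ v → O.to (I.to v)
  ; from     = λ a → I.from (O.from a)
  ; from∘to  = λ v → trans (cong I.from (O.from∘to (I.to v))) (I.inverseʳ refl)
  ; to∘from  = λ a → trans (cong O.to (I.inverseˡ refl)) (O.to∘from a)
  ; to-adj   = λ e → O.to-adj (Equivalence.to (_≅_.adj⇔adj ι _ _) e)
  ; from-adj = λ e → Equivalence.from (_≅_.adj⇔adj ι _ _)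
      (subst₂ (Adj H) (sym (I.inverseˡ refl)) (sym (I.inverseˡ refl)) (O.from-adj e))
  }
  where
  module O = Oriented o
  module I = Inverse (_≅_.bij ι)

-- The start of the construction: `height-top` gives the top the label `m`, which the complement
-- turns into 0.
piece-graceful : ∀ P → RootedGraceful (Piece.Edge P) (top (Piece.tree P))
piece-graceful P = complement (Piece.gracefulOn P) ,
  trans (cong (Piece.m P ∸_) (height-top (Piece.tree P))) (n∸n≡0 (Piece.m P))

theorem4p5 : (L : FiniteGraph) → IsLobster (graph L) → PairwiseLinked (graph L) → Graceful L
theorem4p5 L _ pl = gracefulOn⇒graceful L (Oriented.to o) (Oriented.to-injective o) (Oriented.to-adj o)
  (λ e → _ , _ , Oriented.from-adj o e , Oriented.to∘from o _ , Oriented.to∘from o _)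
  (rest-graceful _ (pieces C) (counts C) (piece-graceful (pieces C zero)))
  where
  module L = PairwiseLinked pl

  C : LinkedLobes L.p
  C = record { lobe = L.lobe ; linkTree = L.link ; linked = L.linked ; linked-last = L.linked-last }

  o : Oriented (graph L) (SpineEdge C)
  o = oriented-≅ L.desc (OrientedSpine.oriented (orientedSpine C))
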